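{- Let $q$ be an odd prime power, $d\ge2$, $Q$ a nondegenerate quadratic form on $\mathbb F_q^d$, and let $\Omega$ be the family of all $q^{d+1}$ parametrized $Q$-spheres. Let $P\subseteq\mathbb F_q^d$ be nonempty, put $n=|P|$, let $\varnothing\ne\mathcal S\subsetneq\Omega$, put $s=|\mathcal S|$, and write $$M=|\Omega|=q^{d+1},\qquad\alpha=q^d-q^{d-1},\qquad\Delta=\sqrt{\alpha ns(1-s/M)}.$$ Suppose $0\le\delta<1$ and $$|\sigma(P,\mathcal S)|\ge(1-\delta)\Delta.$$ Let $\epsilon=\operatorname{sgn}\sigma(P,\mathcal S)$. Then $$\sum_{T\in\Omega}\left(\frac{|P\cap T|-n/q}{\sqrt{\alpha n}}-\epsilon\,\frac{\mathbf 1_{\mathcal S}(T)-s/M}{\sqrt{s(1-s/M)}}\right)^2\le2\delta$$ and $$\sum_{x\in\mathbb F_q^d}\left(\frac{\mathbf 1_P(x)}{\sqrt n}-\epsilon\,\frac{d_{\mathcal S}(x)-s/q}{\sqrt{\alpha s(1-s/M)}}\right)^2\le2\delta.$$ In particular, equality $|\sigma(P,\mathcal S)|=\Delta$ holds if and only if the following equivalent two-level identities hold: $$|P\cap T|-\frac nq=\epsilon\sqrt{\frac{\alpha n}{s(1-s/M)}}\left(\mathbf 1_{\mathcal S}(T)-\frac sM\right)\quad(T\in\Omega),$$ $$d_{\mathcal S}(x)-\frac sq=\epsilon\sqrt{\frac{\alpha s(1-s/M)}n}\,\mathbf 1_P(x)\quad(x\in\mathbb F_q^d);$$ that is, equality is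 equivalent to the first identity and also equivalent to the second.
   Context: For $c\in\mathbb F_q^d$, $r\in\mathbb F_q$ the $Q$-sphere is $S_Q(c,r)=\{x\in\mathbb F_q^d:Q(x-c)=r\}$ (radius zero included); spheres are parametrized by pairs $(c,r)$ and distinct spheres means distinct parameter pairs. $\sigma(P,\mathcal S)=|\{(p,S)\in P\times\mathcal S:p\in S\}|-|P||\mathcal S|/q$. For $x\in\mathbb F_q^d$, $d_{\mathcal S}(x)=|\{S\in\mathcal S:x\in S\}|$. $\mathbf 1_A$ denotes an indicator function. -}

module Defs where

open import Level using (Level) renaming (zero to 0ℓ; suc to lsuc)
open import Algebra.Bundles using (CommutativeRing)
open import Algebra.Core using (Op₁; Op₂)
open import Algebra.Structures using (IsCommutativeRing)
import Algebra.Definitions.RawMonoid as RawMonoidDefs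
import Algebra.Solver.Ring.NaturalCoefficients.Default as SemiringSolver
open import Data.Bool.Base using (Bool; true; false; _∧_; if_then_else_)
open import Data.Empty using (⊥-elim)
open import Data.Fin.Base using (Fin)
open import Data.Fin.Properties using (inj⇒≟)
open import Data.List.Base using (List; []; _∷_; map; foldr; length; filterᵇ; allFin; cartesianProduct; cartesianProductWith)
open import Data.Nat.Base as ℕ using (ℕ; zero; suc; _^_; _∸_)
open import Data.Nat.Primality using (Prime)
open import Data.Product.Base using (∃; ∃₂; _×_; _,_; proj₁; proj₂)
open import Data.Sum.Base using (_⊎_; inj₁; inj₂)
open import Data.Vec.Base as Vec using (Vec; []; _∷_)
open import Function.Bundles using (_↔_; Inverse)
open import Function.Properties.Inverse using (↔⇒↣)
open import Relation.Binary.Core using (Rel)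
open import Relation.Binary.Definitions using (DecidableEquality; tri<; tri≈; tri>)
open import Relation.Binary.PropositionalEquality.Core using (_≡_; _≢_)
open import Relation.Binary.Structures using (IsStrictTotalOrder)
open import Relation.Nullary.Decidable.Core using (does)
open import Relation.Nullary.Negation.Core using (¬_)
open import Relation.Unary using (Pred)

-- ℝ is axiomatised as a Dedekind-complete totally ordered field, which
-- determines it up to unique isomorphism.  Trichotomy is decidable, as
-- in classical analysis.

record CompleteOrderedField (a : Level) : Set (lsuc a) where
  infix  8 -_
  infixl 7 _*_
  infixl 6 _+_
  infix  4 _≈_ _<_ _≤_
  field
    Carrier            : Set a
    _≈_ _<_            : Rel Carrier a
    _+_ _*_            : Op₂ Carrier
    -_                 : Op₁ Carrier
    0# 1#              : Carrier
    isCommutativeRing  : IsCommutativeRing _≈_ _+_ _*_ -_ 0# 1#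
    1≉0                : ¬ (1# ≈ 0#)
    inverse            : ∀ x → ¬ (x ≈ 0#) → ∃ λ y → x * y ≈ 1#
    isStrictTotalOrder : IsStrictTotalOrder _≈_ _<_
    +-monoˡ-<          : ∀ z {x y} → x < y → x + z < y + z
    *-pos              : ∀ {x y} → 0# < x → 0# < y → 0# < x * y

  _≤_ : Rel Carrier a
  x ≤ y = x < y ⊎ x ≈ y

  UpperBound : Pred Carrier a → Carrier → Set a
  UpperBound A b = ∀ y → A y → y ≤ b

  field
    supremum : (A : Pred Carrier a) → ∃ A → ∃ (UpperBound A) →
               ∃ λ s → UpperBound A s × (∀ b → UpperBound A b → s ≤ b)

  commutativeRing : CommutativeRing a a
  commutativeRing = record { isCommutativeRing = isCommutativeRing }

module OrderedFieldProperties {a} (ℝ : CompleteOrderedField a) where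
  open CompleteOrderedField ℝ using (1≉0; inverse; isStrictTotalOrder; _<_; _≤_; +-monoˡ-<; *-pos; UpperBound; supremum)
  open CommutativeRing (CompleteOrderedField.commutativeRing ℝ)
  open IsStrictTotalOrder isStrictTotalOrder using (compare; irrefl; <-respˡ-≈; <-respʳ-≈) renaming (trans to <-trans)
  open SemiringSolver commutativeSemiring using (solve; _:+_; _:*_; _:=_; con)

  +-cancelʳ : ∀ z {x y} → x + z ≈ y + z → x ≈ y
  +-cancelʳ z {x} {y} e = trans (sym (lem x)) (trans (+-congʳ e) (lem y))
    where
    lem : ∀ w → w + z + - z ≈ w
    lem w = trans (+-assoc w z (- z)) (trans (+-congˡ (-‿inverseʳ z)) (+-identityʳ w))

  <⇒+ : ∀ {x y} → x < y → ∃ λ e → 0# < e × x + e ≈ y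
  <⇒+ {x} {y} p = y + - x
    , <-respˡ-≈ (-‿inverseʳ x) (+-monoˡ-< (- x) p)
    , trans (+-comm x (y + - x))
        (trans (+-assoc y (- x) x) (trans (+-congˡ (-‿inverseˡ x)) (+-identityʳ y)))

  +⇒< : ∀ {x y e} → 0# < e → x + e ≈ y → x < y
  +⇒< {x} {y} {e} p q = <-respʳ-≈ (trans (+-comm e x) q) (<-respˡ-≈ (+-identityˡ x) (+-monoˡ-< x p))

  ≤-<-trans : ∀ {x y z} → x ≤ y → y < z → x < z
  ≤-<-trans (inj₁ p) q = <-trans p q
  ≤-<-trans (inj₂ e) q = <-respˡ-≈ (sym e) q

  ≤-respˡ-≈ : ∀ {x y z} → x ≈ y → x ≤ z → y ≤ z
  ≤-respˡ-≈ e (inj₁ p) = inj₁ (<-respˡ-≈ e p)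
  ≤-respˡ-≈ e (inj₂ p) = inj₂ (trans (sym e) p)

  ¬≤∧> : ∀ {x y} → x ≤ y → y < x → ∀ {w} {W : Set w} → W
  ¬≤∧> p q = ⊥-elim (irrefl refl (≤-<-trans p q))

  ≮⇒≤ : ∀ {x y} → ¬ (y < x) → x ≤ y
  ≮⇒≤ {x} {y} n with compare x y
  ... | tri< p _ _ = inj₁ p
  ... | tri≈ _ p _ = inj₂ p
  ... | tri> _ _ p = ⊥-elim (n p)

  +-nonneg-pos : ∀ {x y} → 0# ≤ x → 0# < y → 0# < x + y
  +-nonneg-pos p q = ≤-<-trans p (+⇒< q refl)

  *-nonneg : ∀ {x y} → 0# ≤ x → 0# ≤ y → 0# ≤ x * y
  *-nonneg (inj₁ p) (inj₁ q) = inj₁ (*-pos p q)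
  *-nonneg {x} {y} (inj₂ p) _ = inj₂ (sym (trans (*-congʳ (sym p)) (zeroˡ y)))
  *-nonneg {x} {y} (inj₁ _) (inj₂ q) = inj₂ (sym (trans (*-congˡ (sym q)) (zeroʳ x)))

  +-nonneg : ∀ {x y} → 0# ≤ x → 0# ≤ y → 0# ≤ x + y
  +-nonneg p (inj₁ q) = inj₁ (+-nonneg-pos p q)
  +-nonneg {x} {y} p (inj₂ q) with p
  ... | inj₁ p′ = inj₁ (<-respʳ-≈ (trans (sym (+-identityʳ x)) (+-congˡ q)) p′)
  ... | inj₂ p′ = inj₂ (trans (sym (+-identityʳ 0#)) (+-cong p′ q))

  0<1 : 0# < 1#
  0<1 with compare 0# 1#
  ... | tri< p _ _ = p
  ... | tri≈ _ p _ = ⊥-elim (1≉0 (sym p))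
  ... | tri> _ _ p with <⇒+ p
  ...   | e , 0<e , q = ⊥-elim (irrefl refl (<-trans (<-respʳ-≈ ee≈1 (*-pos 0<e 0<e)) p))
    where
    -- e = - 1
    ee≈1 : e * e ≈ 1#
    ee≈1 = +-cancelʳ e (trans (solve 1 (λ x → x :* x :+ x := x :* (con 1 :+ x)) refl e)
             (trans (*-congˡ q) (trans (zeroʳ e) (sym q))))

  sq-mono-< : ∀ {x y} → 0# ≤ x → x < y → x * x < y * y
  sq-mono-< {x} {y} p x<y with <⇒+ x<y
  ... | e , 0<e , q = +⇒<
    (+-nonneg-pos (*-nonneg (+-nonneg p p) (inj₁ 0<e)) (*-pos 0<e 0<e))
    (trans (solve 2 (λ x e → x :* x :+ ((x :+ x) :* e :+ e :* e) := (x :+ e) :* (x :+ e)) refl x e)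
           (*-cong q q))

  posInverse : ∀ {x} → 0# < x → ∃ λ i → 0# < i × x * i ≈ 1#
  posInverse {x} 0<x with inverse x (λ e → irrefl (sym e) 0<x)
  ... | i , xi≈1 with compare 0# i
  ...   | tri< p _ _ = i , p , xi≈1
  ...   | tri≈ _ p _ = ⊥-elim (1≉0 (trans (sym xi≈1) (trans (*-congˡ (sym p)) (zeroʳ x))))
  ...   | tri> _ _ p with <⇒+ p
  ...     | e , 0<e , q = ⊥-elim (irrefl refl (<-respʳ-≈
            (trans (+-congʳ (sym xi≈1)) (trans (sym (distribˡ x i e)) (trans (*-congˡ q) (zeroʳ x))))
            (+-nonneg-pos (inj₁ 0<1) (*-pos 0<x 0<e))))

  module _ {x} (0≤x : 0# ≤ x) where

    SquareBelow : Pred Carrier a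
    SquareBelow y = y * y ≤ x

    0∈SquareBelow : SquareBelow 0#
    0∈SquareBelow = ≤-respˡ-≈ (sym (zeroʳ 0#)) 0≤x

    SquareBelow-bounded : UpperBound SquareBelow (x + 1#)
    SquareBelow-bounded y y∈A = ≮⇒≤ λ b<y → ¬≤∧> y∈A (<-trans
      (+⇒< (+-nonneg-pos (+-nonneg (*-nonneg 0≤x 0≤x) 0≤x) 0<1)
        (solve 1 (λ x → x :+ (x :* x :+ x :+ con 1) := (x :+ con 1) :* (x :+ con 1)) refl x))
      (sq-mono-< (+-nonneg 0≤x (inj₁ 0<1)) b<y))

    module _ {s} (upper : UpperBound SquareBelow s) (least : ∀ b → UpperBound SquareBelow b → s ≤ b) where

      0≤sup : 0# ≤ s
      0≤sup = upper 0# 0∈SquareBelow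

      sup²≮x : ¬ (s * s < x)
      sup²≮x p with <⇒+ p
      ... | D , 0<D , q with posInverse (+-nonneg-pos (+-nonneg (+-nonneg 0≤sup 0≤sup) (inj₁ 0<1)) 0<D)
      ...   | i , 0<i , r = ¬≤∧> (upper (s + h) (inj₁ [s+h]²<x)) (+⇒< 0<h refl)
        where
        h e : Carrier
        h = D * i
        e = (s + s + 1#) * i
        0<h : 0# < h
        0<h = *-pos 0<D 0<i
        0<e : 0# < e
        0<e = *-pos (+-nonneg-pos (+-nonneg 0≤sup 0≤sup) 0<1) 0<i
        h+e≈1 : h + e ≈ 1#
        h+e≈1 = trans (solve 3 (λ s D i → D :* i :+ (s :+ s :+ con 1) :* i := (s :+ s :+ con 1 :+ D) :* i) refl s D i) r
        D≈ : h * (s + s + (h + e)) + h * D ≈ D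
        D≈ = trans (+-congʳ (*-congˡ (+-congˡ h+e≈1)))
               (trans (solve 3 (λ s D i → D :* i :* (s :+ s :+ con 1) :+ D :* i :* D := D :* ((s :+ s :+ con 1 :+ D) :* i)) refl s D i)
                 (trans (*-congˡ r) (*-identityʳ D)))
        [s+h]²<x : (s + h) * (s + h) < x
        [s+h]²<x = +⇒< (+-nonneg-pos (inj₁ (*-pos 0<h 0<e)) (*-pos 0<h 0<D))
          (trans (solve 4 (λ s h e D → (s :+ h) :* (s :+ h) :+ (h :* e :+ h :* D)
                             := s :* s :+ (h :* (s :+ s :+ (h :+ e)) :+ h :* D)) refl s h e D)
            (trans (+-congˡ D≈) q))

      x≮sup² : ¬ (x < s * s)
      x≮sup² p with <⇒+ p
      ... | D , 0<D , q with posInverse (+-nonneg-pos 0≤sup 0<s)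
        where
        0<s : 0# < s
        0<s with 0≤sup
        ... | inj₁ r = r
        ... | inj₂ r = ¬≤∧> 0≤x (<-respʳ-≈ (trans (*-congʳ (sym r)) (zeroˡ s)) p)
      ...   | i , 0<i , r = ¬≤∧> (least t t-bound) (+⇒< 0<h t+h≈s)
        where
        h t : Carrier
        h = D * i
        t = s + - h
        0<h : 0# < h
        0<h = *-pos 0<D 0<i
        t+h≈s : t + h ≈ s
        t+h≈s = trans (+-assoc s (- h) h) (trans (+-congˡ (-‿inverseˡ h)) (+-identityʳ s))
        h2s≈D : h * (s + s) ≈ D
        h2s≈D = trans (solve 3 (λ D i s → D :* i :* (s :+ s) := D :* ((s :+ s) :* i)) refl D i s)
                  (trans (*-congˡ r) (*-identityʳ D))
        0≤t : 0# ≤ t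
        0≤t = ≮⇒≤ λ t<0 → t≮0 (<⇒+ t<0)
          where
          t≮0 : ¬ (∃ λ e → 0# < e × t + e ≈ 0#)
          t≮0 (e , 0<e , te) = irrefl refl (+⇒< pos eq)
            where
            s+e≈h : s + e ≈ h
            s+e≈h = trans (+-congʳ (sym t+h≈s))
                      (trans (solve 3 (λ t h e → t :+ h :+ e := t :+ e :+ h) refl t h e)
                        (trans (+-congʳ te) (+-identityˡ h)))
            pos : 0# < x + (s * s + e * (s + s))
            pos with compare 0# s
            ... | tri< 0<s _ _ = +-nonneg-pos 0≤x (+-nonneg-pos (*-nonneg 0≤sup 0≤sup) (*-pos 0<e (+-nonneg-pos 0≤sup 0<s)))
            ... | tri> _ _ s<0 = ¬≤∧> 0≤sup s<0
            ... | tri≈ _ 0≈s _ = ¬≤∧> 0≤x (<-respʳ-≈ (trans (*-congʳ (sym 0≈s)) (zeroˡ s)) p)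
            eq : s * s + (x + (s * s + e * (s + s))) ≈ s * s
            eq = trans (solve 3 (λ s e x → s :* s :+ (x :+ (s :* s :+ e :* (s :+ s))) := x :+ (s :+ e) :* (s :+ s)) refl s e x)
                   (trans (+-congˡ (trans (*-congʳ s+e≈h) h2s≈D)) q)
        x<t² : x < t * t
        x<t² = +⇒< (*-pos 0<h 0<h) (+-cancelʳ (h * (t + t) + h * h)
          (trans (solve 3 (λ x t h → x :+ h :* h :+ (h :* (t :+ t) :+ h :* h) := x :+ h :* (t :+ h :+ (t :+ h))) refl x t h)
            (trans (+-congˡ (trans (*-congˡ (+-cong t+h≈s t+h≈s)) h2s≈D))
              (trans q (trans (*-cong (sym t+h≈s) (sym t+h≈s))
                (solve 2 (λ t h → (t :+ h) :* (t :+ h) := t :* t :+ (h :* (t :+ t) :+ h :* h)) refl t h))))))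
        t-bound : ∀ y → SquareBelow y → y ≤ t
        t-bound y y∈A = ≮⇒≤ λ t<y → ¬≤∧> y∈A (<-trans x<t² (sq-mono-< 0≤t t<y))

      sup²≈x : s * s ≈ x
      sup²≈x with compare (s * s) x
      ... | tri< p _ _ = ⊥-elim (sup²≮x p)
      ... | tri≈ _ p _ = p
      ... | tri> _ _ p = ⊥-elim (x≮sup² p)

  abstract
    sqrt : ∀ x → 0# ≤ x → ∃ λ y → 0# ≤ y × y * y ≈ x
    sqrt x 0≤x with supremum (SquareBelow 0≤x) (0# , 0∈SquareBelow 0≤x) (x + 1# , SquareBelow-bounded 0≤x)
    ... | s , upper , least = s , 0≤sup 0≤x upper least , sup²≈x 0≤x upper least

module RealOperations {a} (ℝ : CompleteOrderedField a) where
  open CompleteOrderedField ℝ using (inverse; isStrictTotalOrder; _<_; _≤_) public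
  open CommutativeRing (CompleteOrderedField.commutativeRing ℝ)
    using (Carrier; _≈_; _+_; _*_; -_; _-_; 0#; 1#; +-rawMonoid; sym) public
  open IsStrictTotalOrder isStrictTotalOrder using (compare)
  open OrderedFieldProperties ℝ using (sqrt)

  infix  9 _⁻¹
  infixl 7 _/_
  infixl 9 _²

  fromℕ : ℕ → Carrier
  fromℕ n = n ×ᴹ 1#
    where open RawMonoidDefs +-rawMonoid renaming (_×_ to _×ᴹ_)

  -- Totalised by 0 ⁻¹ = 0.
  _⁻¹ : Carrier → Carrier
  x ⁻¹ with compare x 0#
  ... | tri< _ x≉0 _ = proj₁ (inverse x x≉0)
  ... | tri≈ _ _   _ = 0#
  ... | tri> _ x≉0 _ = proj₁ (inverse x x≉0)

  _/_ : Carrier → Carrier → Carrier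
  x / y = x * y ⁻¹

  _² : Carrier → Carrier
  x ² = x * x

  -- Totalised by √ x = 0 for x < 0.
  √ : Carrier → Carrier
  √ x with compare 0# x
  ... | tri< 0<x _ _ = proj₁ (sqrt x (inj₁ 0<x))
  ... | tri≈ _ 0≈x _ = proj₁ (sqrt x (inj₂ 0≈x))
  ... | tri> _ _   _ = 0#

  ∣_∣ : Carrier → Carrier
  ∣ x ∣ with compare 0# x
  ... | tri< _ _ _ = x
  ... | tri≈ _ _ _ = x
  ... | tri> _ _ _ = - x

  sgn : Carrier → Carrier
  sgn x with compare 0# x
  ... | tri< _ _ _ = 1#
  ... | tri≈ _ _ _ = 0#
  ... | tri> _ _ _ = - 1#

  ∑ : ∀ {b} {A : Set b} → List A → (A → Carrier) → Carrier
  ∑ xs f = foldr (λ x acc → f x + acc) 0# xs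

  𝟏 : ∀ {b} {A : Set b} → (A → Bool) → A → Carrier
  𝟏 B x = if B x then 1# else 0#

record FiniteField (q : ℕ) : Set₁ where
  infix  8 -_
  infixl 7 _*_
  infixl 6 _+_
  field
    Carrier           : Set
    _+_ _*_           : Op₂ Carrier
    -_                : Op₁ Carrier
    0# 1#             : Carrier
    isCommutativeRing : IsCommutativeRing _≡_ _+_ _*_ -_ 0# 1#
    1≢0               : 1# ≢ 0#
    inverse           : ∀ x → x ≢ 0# → ∃ λ y → x * y ≡ 1#
    enumeration       : Carrier ↔ Fin q

  commutativeRing : CommutativeRing 0ℓ 0ℓ
  commutativeRing = record { isCommutativeRing = isCommutativeRing }

  open CommutativeRing commutativeRing public using (_-_)

  _≟_ : DecidableEquality Carrier
  _≟_ = inj⇒≟ (↔⇒↣ enumeration)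

  elements : List Carrier
  elements = map (Inverse.from enumeration) (allFin q)

OddPrimePower : ℕ → Set
OddPrimePower q = ∃₂ λ p k → Prime p × p ≢ 2 × 1 ℕ.≤ k × q ≡ p ^ k

-- Finite subsets are Boolean-valued predicates.

FinSubset : Set → Set
FinSubset A = A → Bool

Nonempty : ∀ {A} → FinSubset A → Set
Nonempty B = ∃ λ x → B x ≡ true

Proper : ∀ {A} → FinSubset A → Set
Proper B = ∃ λ x → B x ≡ false

-- The list is meant to enumerate A without repetition.
card : ∀ {A} → List A → FinSubset A → ℕ
card universe B = length (filterᵇ B universe)

module AffineSpace {q} (F : FiniteField q) (d : ℕ) where
  private module F = FiniteField F

  infixl 6 _⊕_ _⊖_
  infixr 7 _·_

  Point : Set
  Point = Vec F.Carrier d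

  _⊕_ _⊖_ : Op₂ Point
  _⊕_ = Vec.zipWith F._+_
  _⊖_ = Vec.zipWith F._-_

  _·_ : F.Carrier → Point → Point
  a · x = Vec.map (a F.*_) x

  𝟎 : Point
  𝟎 = Vec.replicate d F.0#

  polar : (Point → F.Carrier) → Point → Point → F.Carrier
  polar Q x y = Q (x ⊕ y) F.- Q x F.- Q y

  -- polar Q is symmetric, so linearity in the first argument suffices.
  record IsQuadraticForm (Q : Point → F.Carrier) : Set where
    field
      homogeneous : ∀ a x → Q (a · x) ≡ a F.* a F.* Q x
      polar-⊕     : ∀ x x′ y → polar Q (x ⊕ x′) y ≡ polar Q x y F.+ polar Q x′ y
      polar-·     : ∀ a x y → polar Q (a · x) y ≡ a F.* polar Q x y

  Nondegenerate : (Point → F.Carrier) → Set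
  Nondegenerate Q = ∀ x → (∀ y → polar Q x y ≡ F.0#) → x ≡ 𝟎

  vectors : ∀ k → List (Vec F.Carrier k)
  vectors zero    = [] ∷ []
  vectors (suc k) = cartesianProductWith _∷_ F.elements (vectors k)

  points : List Point
  points = vectors d

  -- A sphere is its pair of parameters (centre , radius).
  Sphere : Set
  Sphere = Point × F.Carrier

  Ω : List Sphere
  Ω = cartesianProduct points F.elements

  inSphere : (Point → F.Carrier) → Point → Sphere → Bool
  inSphere Q x (c , r) = does (Q (x ⊖ c) F.≟ r)

module Incidence {a} (ℝ : CompleteOrderedField a) {q} (F : FiniteField q) {d}
  (Q : AffineSpace.Point F d → FiniteField.Carrier F)
  (P : FinSubset (AffineSpace.Point F d))
  (𝒮 : FinSubset (AffineSpace.Sphere F d)) where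
  open RealOperations ℝ
  open AffineSpace F d

  -- 𝐪, 𝐧, 𝐬, M are the real numbers q, n = |P|, s = |𝒮| and |Ω|.
  𝐪 𝐧 𝐬 M α Δ σ ε : Carrier

  𝐪 = fromℕ q
  𝐧 = fromℕ (card points P)
  𝐬 = fromℕ (card Ω 𝒮)
  M = fromℕ (q ^ suc d)
  α = fromℕ (q ^ d) - fromℕ (q ^ (d ∸ 1))
  Δ = √ (α * 𝐧 * 𝐬 * (1# - 𝐬 / M))

  incidences : ℕ
  incidences = card (cartesianProduct points Ω) λ (x , T) → P x ∧ 𝒮 T ∧ inSphere Q x T

  σ = fromℕ incidences - 𝐧 * 𝐬 / 𝐪
  ε = sgn σ

  ∣P∩_∣ : Sphere → Carrier
  ∣P∩ T ∣ = fromℕ (card points λ x → P x ∧ inSphere Q x T)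

  d𝒮 : Point → Carrier
  d𝒮 x = fromℕ (card Ω λ T → 𝒮 T ∧ inSphere Q x T)

{-# OPTIONS --safe #-}
module Submission where

open import Defs
open import Algebra.Bundles using (CommutativeRing)
import Algebra.Properties.Ring as RingProperties
import Algebra.Properties.Semiring.Mult as UnoptimisedMult
import Algebra.Properties.Semiring.Mult.TCOptimised as Mult
import Algebra.Solver.Ring as RingSolver
open import Algebra.Solver.Ring.AlmostCommutativeRing using (fromCommutativeRing; _-Raw-AlmostCommutative⟶_)
open import Data.Bool.Base using (Bool; true; false; _∧_; not; if_then_else_)
open import Data.Empty using (⊥-elim)
open import Data.Fin.Base using (Fin; zero; suc)
open import Data.Integer.Base as ℤ using (ℤ; +_; -[1+_])
import Data.Integer.Properties as ℤₚ
open import Data.List.Base using (List; []; _∷_; _++_; map; length; allFin; tabulate; cartesianProduct; cartesianProductWith)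
open import Data.List.Membership.Propositional using (_∈_; lose)
open import Data.List.Membership.Propositional.Properties using (∈-map⁺; ∈-allFin; ∈-cartesianProductWith⁺; ∈-cartesianProduct⁺)
open import Data.List.Properties using (map-tabulate; length-tabulate)
open import Data.List.Relation.Unary.Any using (here; there; any?; satisfied)
import Data.Maybe.Base as Maybe
open import Data.Nat.Base as ℕ using (ℕ; zero; suc; _^_)
import Data.Nat.Properties as ℕₚ
open import Data.Product.Base using (∃; _×_; _,_; proj₁; proj₂)
open import Data.Sum.Base using (inj₁; inj₂)
open import Data.Vec.Base using (Vec; []; _∷_)
open import Data.Vec.Properties using (≡-dec; ∷-injectiveˡ; ∷-injectiveʳ)
open import Function.Base using (_∘_; id)
open import Function.Bundles using (_⇔_; mk⇔; _↔_; Inverse)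
import Relation.Binary.Construct.StrictToNonStrict as StrictToNonStrict
open import Relation.Binary.Definitions using (DecidableEquality; tri<; tri≈; tri>)
open import Relation.Binary.PropositionalEquality.Core as ≡ using (_≡_; _≢_)
open import Relation.Binary.PropositionalEquality.Properties using (module ≡-Reasoning)
open import Relation.Binary.Structures using (IsStrictTotalOrder; IsPartialOrder)
open import Relation.Nullary.Decidable.Core using (Dec; does; yes; no; ¬?; decidable-stable; dec⇒maybe)
open import Relation.Nullary.Negation.Core using (¬_)

-- Let K be the incidence matrix of points against spheres, centred by
-- subtracting 1/q.  Two distinct points lie on exactly q^(d-1) common
-- spheres, because the centres c with Q(x - c) = Q(y - c) form an affine
-- hyperplane; hence K K* = α, so K*/√α is an isometry and K/√α a contraction.
-- With w = 1_S - s/M, the deviation of |P ∩ T| is K* 1_P, that of d_S is K w,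
-- and σ = ⟨K* 1_P, w⟩ = ⟨1_P, K w⟩.  Both inequalities expand ‖u - ε v‖² with
-- ⟨u, v⟩ = σ/Δ, where u and v have norm at most one.

-- Centring by 1/q is removal of the mean, since a point lies on q^d of the q^(d+1) spheres. It
-- lowers every count of common spheres by q^(2d) / q^(d+1) = q^(d-1), which is exactly the count
-- for two distinct points. Only the diagonal survives, and there the excess is α = q^d - q^(d-1).
--
-- The two spaces play different roles. On spheres the norms of `f` = K* 1_P and of `w` are both
-- known exactly. On points the norm of 1_P is exact, while that of `g` = K w is only bounded,
-- because K merely contracts. The Cauchy-Schwarz argument is therefore set up with one exact and
-- one bounded norm. This is enough for equality too: a vanishing defect expresses the second
-- function as a multiple of the first, and conversely such a multiple determines the inner product
-- from the exact norm alone.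
--
-- Expanding the square needs ε² = 1, which fails for σ = 0. The hypothesis δ < 1 excludes that
-- case, because it makes the lower bound (1 - δ) Δ positive.

-- Ring solver with integer coefficients over any commutative ring.

module IntegerCoefficientSolver {c ℓ} (R : CommutativeRing c ℓ) where
  open CommutativeRing R
  open RingProperties ring using (-0#≈0#; -‿+-comm; -‿involutive; -‿distribˡ-*; -‿distribʳ-*)
  open Mult semiring using (×-homo-+; ×1-homo-*) renaming (_×_ to _×ᴹ_)
  open import Relation.Binary.Reasoning.Setoid setoid

  private
    -- The optimised multiple makes `con (+ 0)` and `con (+ 1)` denote `0#` and `1#` by computation,
    -- so solver goals match expressions containing these constants up to `refl`.
    ⟦_⟧ : ℤ → Carrier
    ⟦ + n ⟧      = n ×ᴹ 1#
    ⟦ -[1+ n ] ⟧ = - (suc n ×ᴹ 1#)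

    ⟦-⟧ : ∀ n → ⟦ ℤ.- (+ n) ⟧ ≈ - (n ×ᴹ 1#)
    ⟦-⟧ zero    = sym -0#≈0#
    ⟦-⟧ (suc n) = refl

    -‿homo : ∀ i → ⟦ ℤ.- i ⟧ ≈ - ⟦ i ⟧
    -‿homo (+ n)    = ⟦-⟧ n
    -‿homo -[1+ n ] = sym (-‿involutive _)

    suc×ᴹ : ∀ n → suc n ×ᴹ 1# ≈ 1# + n ×ᴹ 1#
    suc×ᴹ n = ×-homo-+ 1# 1 n

    ⊖-homo : ∀ m n → ⟦ m ℤ.⊖ n ⟧ ≈ m ×ᴹ 1# - n ×ᴹ 1#
    ⊖-homo m zero = sym (trans (+-congˡ -0#≈0#) (+-identityʳ _))
    ⊖-homo zero (suc n) = sym (+-identityˡ _)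
    ⊖-homo (suc m) (suc n) = begin
      ⟦ suc m ℤ.⊖ suc n ⟧                        ≡⟨ ≡.cong ⟦_⟧ (ℤₚ.[1+m]⊖[1+n]≡m⊖n m n) ⟩
      ⟦ m ℤ.⊖ n ⟧                                ≈⟨ ⊖-homo m n ⟩
      m ×ᴹ 1# - n ×ᴹ 1#                          ≈⟨ +-congʳ (+-identityˡ _) ⟨
      -- Inserting `1# - 1#` supplies the unit that each of the two successors absorbs.
      (0# + m ×ᴹ 1#) - n ×ᴹ 1#                   ≈⟨ +-congʳ (+-congʳ (-‿inverseʳ 1#)) ⟨
      ((1# - 1#) + m ×ᴹ 1#) - n ×ᴹ 1#            ≈⟨ +-congʳ (trans (+-assoc _ _ _) (trans (+-congˡ (+-comm _ _)) (sym (+-assoc _ _ _)))) ⟩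
      ((1# + m ×ᴹ 1#) - 1#) - n ×ᴹ 1#            ≈⟨ +-assoc _ _ _ ⟩
      (1# + m ×ᴹ 1#) + (- 1# - n ×ᴹ 1#)          ≈⟨ +-congˡ (-‿+-comm _ _) ⟩
      (1# + m ×ᴹ 1#) - (1# + n ×ᴹ 1#)            ≈⟨ +-cong (suc×ᴹ m) (-‿cong (suc×ᴹ n)) ⟨
      suc m ×ᴹ 1# - suc n ×ᴹ 1#                  ∎

    +-homo : ∀ i j → ⟦ i ℤ.+ j ⟧ ≈ ⟦ i ⟧ + ⟦ j ⟧
    +-homo (+ m)    (+ n)    = ×-homo-+ 1# m n
    +-homo (+ m)    -[1+ n ] = ⊖-homo m (suc n)
    +-homo -[1+ m ] (+ n)    = trans (⊖-homo n (suc m)) (+-comm _ _)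
    +-homo -[1+ m ] -[1+ n ] = begin
      - (suc (suc (m ℕ.+ n)) ×ᴹ 1#)      ≈⟨ -‿cong (trans (suc×ᴹ (suc (m ℕ.+ n))) (+-congˡ (×-homo-+ 1# (suc m) n))) ⟩
      - (1# + (suc m ×ᴹ 1# + n ×ᴹ 1#))    ≈⟨ -‿cong (trans (sym (+-assoc _ _ _)) (trans (+-congʳ (+-comm _ _)) (+-assoc _ _ _))) ⟩
      - (suc m ×ᴹ 1# + (1# + n ×ᴹ 1#))    ≈⟨ -‿cong (+-congˡ (suc×ᴹ n)) ⟨
      - (suc m ×ᴹ 1# + suc n ×ᴹ 1#)       ≈⟨ -‿+-comm _ _ ⟨
      - (suc m ×ᴹ 1#) - suc n ×ᴹ 1#       ∎

    ⁺*-homo : ∀ m j → ⟦ + m ℤ.* j ⟧ ≈ m ×ᴹ 1# * ⟦ j ⟧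
    ⁺*-homo m (+ n) = trans (reflexive (≡.cong ⟦_⟧ (≡.sym (ℤₚ.pos-* m n)))) (×1-homo-* m n)
    ⁺*-homo m -[1+ n ] = begin
      ⟦ + m ℤ.* -[1+ n ] ⟧         ≡⟨ ≡.cong ⟦_⟧ (ℤₚ.neg-distribʳ-* (+ m) (+ suc n)) ⟨
      ⟦ ℤ.- (+ m ℤ.* + suc n) ⟧    ≈⟨ -‿homo (+ m ℤ.* + suc n) ⟩
      - ⟦ + m ℤ.* + suc n ⟧        ≈⟨ -‿cong (⁺*-homo m (+ suc n)) ⟩
      - (m ×ᴹ 1# * (suc n ×ᴹ 1#))    ≈⟨ -‿distribʳ-* _ _ ⟩
      m ×ᴹ 1# * - (suc n ×ᴹ 1#)      ∎

    *-homo : ∀ i j → ⟦ i ℤ.* j ⟧ ≈ ⟦ i ⟧ * ⟦ j ⟧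
    *-homo (+ m) j = ⁺*-homo m j
    *-homo -[1+ m ] j = begin
      ⟦ -[1+ m ] ℤ.* j ⟧           ≡⟨ ≡.cong ⟦_⟧ (ℤₚ.neg-distribˡ-* (+ suc m) j) ⟨
      ⟦ ℤ.- (+ suc m ℤ.* j) ⟧      ≈⟨ -‿homo (+ suc m ℤ.* j) ⟩
      - ⟦ + suc m ℤ.* j ⟧          ≈⟨ -‿cong (⁺*-homo (suc m) j) ⟩
      - (suc m ×ᴹ 1# * ⟦ j ⟧)       ≈⟨ -‿distribˡ-* _ _ ⟩
      - (suc m ×ᴹ 1#) * ⟦ j ⟧       ∎

    homomorphism : ℤ.+-*-rawRing -Raw-AlmostCommutative⟶ fromCommutativeRing R
    homomorphism = record
      { ⟦_⟧    = ⟦_⟧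
      ; +-homo = +-homo
      ; *-homo = *-homo
      ; -‿homo = -‿homo
      ; 0-homo = refl
      ; 1-homo = refl
      }

  open RingSolver ℤ.+-*-rawRing (fromCommutativeRing R) homomorphism
    (λ i j → Maybe.map (λ i≡j → reflexive (≡.cong ⟦_⟧ i≡j)) (dec⇒maybe (i ℤₚ.≟ j))) public
    using (solve; _:=_; _:+_; _:*_; _:-_; :-_; con)

-- Ordered-field arithmetic: differences, inverses, square roots and signs.

module OrderedFieldTheory {a} (ℝ : CompleteOrderedField a) where
  open CompleteOrderedField ℝ using (*-pos; +-monoˡ-<)
  open RealOperations ℝ
  open CommutativeRing (CompleteOrderedField.commutativeRing ℝ)
    hiding (Carrier; _≈_; _+_; _*_; -_; _-_; 0#; 1#; +-rawMonoid; sym; zero)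
  open OrderedFieldProperties ℝ
  open IntegerCoefficientSolver (CompleteOrderedField.commutativeRing ℝ)
  open UnoptimisedMult semiring using (×1-homo-*)
  open IsStrictTotalOrder isStrictTotalOrder using (compare; irrefl; <-respˡ-≈; <-respʳ-≈; isStrictPartialOrder)
    renaming (trans to <-trans)
  open IsPartialOrder (StrictToNonStrict.isPartialOrder _≈_ _<_ isStrictPartialOrder) public
    using () renaming (trans to ≤-trans; antisym to ≤-antisym)

  ≤-respʳ-≈ : ∀ {x y z} → x ≈ y → z ≤ x → z ≤ y
  ≤-respʳ-≈ e p = ≤-trans p (inj₂ e)

  <-≤-trans : ∀ {x y z} → x < y → y ≤ z → x < z
  <-≤-trans x<y (inj₁ y<z) = <-trans x<y y<z
  <-≤-trans x<y (inj₂ y≈z) = <-respʳ-≈ y≈z x<y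

  <⇒≉ : ∀ {x} → 0# < x → ¬ (x ≈ 0#)
  <⇒≉ p e = irrefl (sym e) p

  0<y-x : ∀ {x y} → x < y → 0# < y - x
  0<y-x {x} p = <-respˡ-≈ (-‿inverseʳ x) (+-monoˡ-< (- x) p)

  0≤y-x : ∀ {x y} → x ≤ y → 0# ≤ y - x
  0≤y-x     (inj₁ p) = inj₁ (0<y-x p)
  0≤y-x {x} (inj₂ e) = inj₂ (trans (sym (-‿inverseʳ x)) (+-congʳ e))

  -- Turns an inequality into nonnegativity of a difference, which the ring solver can rewrite as a
  -- sum or product of nonnegative terms. Most inequalities below are proved this way.
  0≤y-x⇒x≤y : ∀ {x y} → 0# ≤ y - x → x ≤ y
  0≤y-x⇒x≤y {x} {y} p = ≮⇒≤ λ y<x → irrefl refl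
    (<-respʳ-≈ (solve 2 (λ x y → y :- x :+ (x :- y) := con (+ 0)) refl x y) (+-nonneg-pos p (0<y-x y<x)))

  0<y-x⇒x<y : ∀ {x y} → 0# < y - x → x < y
  0<y-x⇒x<y {x} {y} p = +⇒< p (solve 2 (λ x y → x :+ (y :- x) := y) refl x y)

  *-monoˡ-≤ : ∀ {c x y} → 0# ≤ c → x ≤ y → c * x ≤ c * y
  *-monoˡ-≤ {c} {x} {y} 0≤c p = 0≤y-x⇒x≤y (≤-respʳ-≈
    (solve 3 (λ c x y → c :* (y :- x) := c :* y :- c :* x) refl c x y) (*-nonneg 0≤c (0≤y-x p)))

  ²-nonneg : ∀ x → 0# ≤ x ²
  ²-nonneg x with compare 0# x
  ... | tri< p _ _ = inj₁ (*-pos p p)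
  ... | tri≈ _ e _ = inj₂ (sym (trans (*-congʳ (sym e)) (zeroˡ x)))
  ... | tri> _ _ p = inj₁ (<-respʳ-≈ (solve 1 (λ x → (con (+ 0) :- x) :* (con (+ 0) :- x) := x :* x) refl x)
                            (*-pos (0<y-x p) (0<y-x p)))

  ²≈0⇒≈0 : ∀ {x} → x ² ≈ 0# → x ≈ 0#
  ²≈0⇒≈0 {x} e with compare 0# x
  ... | tri< p _ _ = ⊥-elim (<⇒≉ (*-pos p p) e)
  ... | tri≈ _ p _ = sym p
  ... | tri> _ _ p = ⊥-elim (<⇒≉ (*-pos (0<y-x p) (0<y-x p))
                       (trans (solve 1 (λ x → (con (+ 0) :- x) :* (con (+ 0) :- x) := x :* x) refl x) e))

  *-cancelˡ : ∀ {c x y} → 0# < c → c * x ≈ c * y → x ≈ y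
  *-cancelˡ {c} {x} {y} 0<c e with posInverse 0<c
  ... | i , _ , ci≈1 = trans (trans (sym (lem x)) (*-congˡ e)) (lem y)
    where
    lem : ∀ z → i * (c * z) ≈ z
    lem z = trans (solve 3 (λ i c z → i :* (c :* z) := c :* i :* z) refl i c z)
              (trans (*-congʳ ci≈1) (*-identityˡ z))

  *-cancelˡ-≤ : ∀ {c x y} → 0# < c → c * x ≤ c * y → x ≤ y
  *-cancelˡ-≤ {c} {x} {y} 0<c p = ≮⇒≤ λ y<x → ¬≤∧> p (0<y-x⇒x<y (<-respʳ-≈
    (solve 3 (λ c x y → c :* (x :- y) := c :* x :- c :* y) refl c x y) (*-pos 0<c (0<y-x y<x))))

  ⁻¹-inverseʳ : ∀ {x} → 0# < x → x * x ⁻¹ ≈ 1#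
  ⁻¹-inverseʳ {x} 0<x with compare x 0#
  ... | tri< _ x≉0 _ = proj₂ (inverse x x≉0)
  ... | tri≈ _ x≈0 _ = ⊥-elim (<⇒≉ 0<x x≈0)
  ... | tri> _ x≉0 _ = proj₂ (inverse x x≉0)

  -- The field axiom behind `_⁻¹` says nothing about sign, so the inverse is identified with the
  -- positive one from `posInverse` by cancelling `x`.
  ⁻¹-pos : ∀ {x} → 0# < x → 0# < x ⁻¹
  ⁻¹-pos 0<x with posInverse 0<x
  ... | i , 0<i , xi≈1 = <-respʳ-≈ (*-cancelˡ 0<x (trans xi≈1 (sym (⁻¹-inverseʳ 0<x)))) 0<i

  x*[y/x]≈y : ∀ {x} y → 0# < x → x * (y / x) ≈ y
  x*[y/x]≈y {x} y 0<x = trans (solve 3 (λ x y i → x :* (y :* i) := y :* (x :* i)) refl x y (x ⁻¹))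
    (trans (*-congˡ (⁻¹-inverseʳ 0<x)) (*-identityʳ y))

  √-nonneg : ∀ {x} → 0# ≤ x → 0# ≤ √ x
  √-nonneg {x} 0≤x with compare 0# x
  ... | tri< 0<x _ _ = proj₁ (proj₂ (sqrt x (inj₁ 0<x)))
  ... | tri≈ _ 0≈x _ = proj₁ (proj₂ (sqrt x (inj₂ 0≈x)))
  ... | tri> _ _ x<0 = inj₂ refl

  √x²≈x : ∀ {x} → 0# ≤ x → √ x ² ≈ x
  √x²≈x {x} 0≤x with compare 0# x
  ... | tri< 0<x _ _ = proj₂ (proj₂ (sqrt x (inj₁ 0<x)))
  ... | tri≈ _ 0≈x _ = proj₂ (proj₂ (sqrt x (inj₂ 0≈x)))
  ... | tri> _ _ x<0 = ¬≤∧> 0≤x x<0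

  √-pos : ∀ {x} → 0# < x → 0# < √ x
  √-pos 0<x with √-nonneg (inj₁ 0<x)
  ... | inj₁ 0<√x = 0<√x
  ... | inj₂ 0≈√x = ⊥-elim (<⇒≉ 0<x
    (trans (sym (√x²≈x (inj₁ 0<x))) (trans (*-congʳ (sym 0≈√x)) (zeroˡ _))))

  -- Squaring is strictly increasing on nonnegative elements, so a nonnegative root is determined by
  -- its square. Congruence and multiplicativity of `√` then only require exhibiting a candidate
  -- root.
  √-unique : ∀ {x y} → 0# ≤ y → y ² ≈ x → √ x ≈ y
  √-unique {x} {y} 0≤y y²≈x with compare (√ x) y
  ... | tri< √x<y _ _ = ⊥-elim (irrefl (trans (√x²≈x 0≤x) (sym y²≈x)) (sq-mono-< (√-nonneg 0≤x) √x<y))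
    where 0≤x = ≤-respʳ-≈ y²≈x (²-nonneg y)
  ... | tri≈ _ √x≈y _ = √x≈y
  ... | tri> _ _ y<√x = ⊥-elim (irrefl (trans y²≈x (sym (√x²≈x 0≤x))) (sq-mono-< 0≤y y<√x))
    where 0≤x = ≤-respʳ-≈ y²≈x (²-nonneg y)

  √-homo-* : ∀ {x y} → 0# ≤ x → 0# ≤ y → √ (x * y) ≈ √ x * √ y
  √-homo-* {x} {y} 0≤x 0≤y = √-unique (*-nonneg (√-nonneg 0≤x) (√-nonneg 0≤y))
    (trans (solve 2 (λ u v → (u :* v) :* (u :* v) := (u :* u) :* (v :* v)) refl (√ x) (√ y))
           (*-cong (√x²≈x 0≤x) (√x²≈x 0≤y)))

  √-cong : ∀ {x y} → 0# ≤ x → x ≈ y → √ y ≈ √ x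
  √-cong 0≤x x≈y = √-unique (√-nonneg 0≤x) (trans (√x²≈x 0≤x) x≈y)

  -- The quotient rule for roots in multiplied form; it serves to identify `√ (B / A)` with
  -- `√ B / √ A` in the equality case.
  √y*√[x/y]≈√x : ∀ {x y} → 0# ≤ x → 0# < y → √ y * √ (x / y) ≈ √ x
  √y*√[x/y]≈√x {x} {y} 0≤x 0<y =
    trans (sym (√-homo-* (inj₁ 0<y) 0≤x/y)) (√-cong 0≤x (sym (x*[y/x]≈y x 0<y)))
    where
    0≤x/y : 0# ≤ x / y
    0≤x/y = *-nonneg 0≤x (inj₁ (⁻¹-pos 0<y))

  sgn-* : ∀ x → sgn x * x ≈ ∣ x ∣
  sgn-* x with compare 0# x
  ... | tri< _ _ _   = *-identityˡ x
  ... | tri≈ _ 0≈x _ = trans (zeroˡ x) 0≈x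
  ... | tri> _ _ _   = solve 1 (λ x → :- con (+ 1) :* x := :- x) refl x

  sgn²≈1 : ∀ {x} → 0# < ∣ x ∣ → sgn x ² ≈ 1#
  sgn²≈1 {x} p with compare 0# x
  ... | tri< _ _ _   = *-identityˡ 1#
  ... | tri≈ _ 0≈x _ = ⊥-elim (irrefl 0≈x p)
  ... | tri> _ _ _   = solve 0 (:- con (+ 1) :* (:- con (+ 1)) := con (+ 1)) refl


  fromℕ-* : ∀ m n → fromℕ (m ℕ.* n) ≈ fromℕ m * fromℕ n
  fromℕ-* = ×1-homo-*

  fromℕ-nonneg : ∀ n → 0# ≤ fromℕ n
  fromℕ-nonneg zero    = inj₂ refl
  fromℕ-nonneg (suc n) = +-nonneg (inj₁ 0<1) (fromℕ-nonneg n)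

  fromℕ-mono-< : ∀ {m n} → m ℕ.< n → fromℕ m < fromℕ n
  fromℕ-mono-< {zero}  {suc n} _ = <-respʳ-≈ (+-comm _ _) (+-nonneg-pos (fromℕ-nonneg n) 0<1)
  fromℕ-mono-< {suc m} {suc n} (ℕ.s≤s m<n) =
    <-respˡ-≈ (+-comm _ _) (<-respʳ-≈ (+-comm _ _) (+-monoˡ-< 1# (fromℕ-mono-< m<n)))

-- Finite sums, 0/1 brackets, and lists that enumerate a type.

module Summation {a} (ℝ : CompleteOrderedField a) where
  open RealOperations ℝ
  open CommutativeRing (CompleteOrderedField.commutativeRing ℝ)
    hiding (Carrier; _≈_; _+_; _*_; -_; _-_; 0#; 1#; +-rawMonoid; sym; zero)
  open OrderedFieldProperties ℝ
  open OrderedFieldTheory ℝ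
  open IntegerCoefficientSolver (CompleteOrderedField.commutativeRing ℝ)
  open import Relation.Binary.Reasoning.Setoid setoid

  [_] : Bool → Carrier
  [ b ] = if b then 1# else 0#

  []-∧ : ∀ b c → [ b ∧ c ] ≈ [ b ] * [ c ]
  []-∧ true  c = sym (*-identityˡ _)
  []-∧ false c = sym (zeroˡ _)

  []-pos : ∀ {b} → b ≡ true → 0# < [ b ]
  []-pos ≡.refl = 0<1

  []+[not]≈1 : ∀ b → [ b ] + [ not b ] ≈ 1#
  []+[not]≈1 true  = +-identityʳ 1#
  []+[not]≈1 false = +-identityˡ 1#

  []-idem : ∀ b → [ b ] ² ≈ [ b ]
  []-idem true  = *-identityˡ 1#
  []-idem false = zeroˡ 0#

  []-yes : ∀ {p} {P : Set p} (P? : Dec P) → P → [ does P? ] ≈ 1#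
  []-yes (yes _) p = refl
  []-yes (no ¬p) p = ⊥-elim (¬p p)

  []-no : ∀ {p} {P : Set p} (P? : Dec P) → ¬ P → [ does P? ] ≈ 0#
  []-no (yes p) ¬p = ⊥-elim (¬p p)
  []-no (no _)  ¬p = refl

  []-nonneg : ∀ b → 0# ≤ [ b ]
  []-nonneg true  = inj₁ 0<1
  []-nonneg false = inj₂ refl

  module _ {x} {X : Set x} where

    ∑-cong : ∀ xs {f g : X → Carrier} → (∀ x → f x ≈ g x) → ∑ xs f ≈ ∑ xs g
    ∑-cong []       f≈g = refl
    ∑-cong (x ∷ xs) f≈g = +-cong (f≈g x) (∑-cong xs f≈g)

    ∑-zero : (xs : List X) → ∑ xs (λ _ → 0#) ≈ 0#
    ∑-zero []       = refl
    ∑-zero (x ∷ xs) = trans (+-identityˡ _) (∑-zero xs)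

    ∑-distrib-+ : ∀ xs (f g : X → Carrier) → ∑ xs (λ x → f x + g x) ≈ ∑ xs f + ∑ xs g
    ∑-distrib-+ []       f g = sym (+-identityˡ 0#)
    ∑-distrib-+ (x ∷ xs) f g = trans (+-congˡ (∑-distrib-+ xs f g))
      (solve 4 (λ a b c d → (a :+ b) :+ (c :+ d) := (a :+ c) :+ (b :+ d)) refl _ _ _ _)

    *-distribˡ-∑ : ∀ xs c (f : X → Carrier) → c * ∑ xs f ≈ ∑ xs (λ x → c * f x)
    *-distribˡ-∑ []       c f = zeroʳ c
    *-distribˡ-∑ (x ∷ xs) c f = trans (distribˡ c _ _) (+-congˡ (*-distribˡ-∑ xs c f))

    ∑-nonneg : ∀ xs {f : X → Carrier} → (∀ x → 0# ≤ f x) → 0# ≤ ∑ xs f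
    ∑-nonneg []       0≤f = inj₂ refl
    ∑-nonneg (x ∷ xs) 0≤f = +-nonneg (0≤f x) (∑-nonneg xs 0≤f)

    term≤∑ : ∀ {xs x} {f : X → Carrier} → (∀ x → 0# ≤ f x) → x ∈ xs → f x ≤ ∑ xs f
    term≤∑ {x ∷ xs} 0≤f (here ≡.refl) = 0≤y-x⇒x≤y (≤-respʳ-≈
      (solve 2 (λ u v → v := u :+ v :- u) refl _ _) (∑-nonneg xs 0≤f))
    term≤∑ {x ∷ xs} {f = f} 0≤f (there x∈xs) = ≤-trans (term≤∑ 0≤f x∈xs) (0≤y-x⇒x≤y (≤-respʳ-≈
      (solve 2 (λ u v → u := u :+ v :- v) refl (f x) (∑ xs f)) (0≤f x)))

    ∑-pos : ∀ {xs x} {f : X → Carrier} → (∀ x → 0# ≤ f x) → x ∈ xs → 0# < f x → 0# < ∑ xs f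
    ∑-pos 0≤f x∈xs 0<fx = <-≤-trans 0<fx (term≤∑ 0≤f x∈xs)

    ∑-one : (xs : List X) → ∑ xs (λ _ → 1#) ≈ fromℕ (length xs)
    ∑-one []       = refl
    ∑-one (x ∷ xs) = +-congˡ (∑-one xs)

    ∑-++ : ∀ xs ys (f : X → Carrier) → ∑ (xs ++ ys) f ≈ ∑ xs f + ∑ ys f
    ∑-++ []       ys f = sym (+-identityˡ _)
    ∑-++ (x ∷ xs) ys f = trans (+-congˡ (∑-++ xs ys f)) (sym (+-assoc _ _ _))

    ∑-centredʳ : ∀ xs e (f g : X → Carrier) →
      ∑ xs (λ x → f x * (g x - e)) ≈ ∑ xs (λ x → f x * g x) - ∑ xs f * e
    ∑-centredʳ []       e f g = solve 1 (λ e → con (+ 0) := con (+ 0) :- con (+ 0) :* e) refl e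
    ∑-centredʳ (x ∷ xs) e f g = trans (+-congˡ (∑-centredʳ xs e f g))
      (solve 5 (λ u v e H F → u :* (v :- e) :+ (H :- F :* e) := u :* v :+ H :- (u :+ F) :* e)
        refl (f x) (g x) e _ _)

    -- The right side keeps the three sums and the number of terms apart, so that each can be
    -- replaced by its known value: a degree, a codegree, `𝐬` or `M`.
    ∑-centred : ∀ xs c e (f g : X → Carrier) → ∑ xs (λ x → (f x - c) * (g x - e)) ≈
      ∑ xs (λ x → f x * g x) - ∑ xs f * e - (∑ xs g - ∑ xs (λ _ → 1#) * e) * c
    ∑-centred []       c e f g = solve 2 (λ c e → con (+ 0) :=
      con (+ 0) :- con (+ 0) :* e :- (con (+ 0) :- con (+ 0) :* e) :* c) refl c e
    ∑-centred (x ∷ xs) c e f g = trans (+-congˡ (∑-centred xs c e f g))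
      (solve 8 (λ u v c e H F G N → (u :- c) :* (v :- e) :+ (H :- F :* e :- (G :- N :* e) :* c) :=
          u :* v :+ H :- (u :+ F) :* e :- (v :+ G :- (con (+ 1) :+ N) :* e) :* c)
        refl (f x) (g x) c e _ _ _ _)

  fromℕ-card : ∀ {X : Set} (xs : List X) (B : FinSubset X) → fromℕ (card xs B) ≈ ∑ xs (𝟏 B)
  fromℕ-card []       B = refl
  fromℕ-card (x ∷ xs) B with B x
  ... | true  = +-congˡ (fromℕ-card xs B)
  ... | false = trans (fromℕ-card xs B) (sym (+-identityˡ _))

  ∑-map : ∀ {x y} {X : Set x} {Y : Set y} (g : X → Y) xs f → ∑ (map g xs) f ≈ ∑ xs (f ∘ g)
  ∑-map g []       f = refl
  ∑-map g (x ∷ xs) f = +-congˡ (∑-map g xs f)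

  ∑-cartesianProductWith : ∀ {x y z} {X : Set x} {Y : Set y} {Z : Set z} (g : X → Y → Z) xs ys f →
    ∑ (cartesianProductWith g xs ys) f ≈ ∑ xs (λ x → ∑ ys (λ y → f (g x y)))
  ∑-cartesianProductWith g []       ys f = refl
  ∑-cartesianProductWith g (x ∷ xs) ys f =
    trans (∑-++ (map (g x) ys) _ f) (+-cong (∑-map (g x) ys f) (∑-cartesianProductWith g xs ys f))

  ∑-comm : ∀ {x y} {X : Set x} {Y : Set y} (xs : List X) (ys : List Y) (f : X → Y → Carrier) →
    ∑ xs (λ x → ∑ ys (f x)) ≈ ∑ ys (λ y → ∑ xs (λ x → f x y))
  ∑-comm []       ys f = sym (∑-zero ys)
  ∑-comm (x ∷ xs) ys f = trans (+-congˡ (∑-comm xs ys f)) (sym (∑-distrib-+ ys (f x) _))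

  -- Says that every element occurs exactly once in the list.
  Sifting : ∀ {X : Set} → List X → Set a
  Sifting {X} xs = ∀ (f : X → Carrier) x → (∀ y → y ≢ x → f y ≈ 0#) → ∑ xs f ≈ f x

  allFin-sifting : ∀ n → Sifting (allFin n)
  allFin-sifting (suc n) f i f≈0 = trans (+-congˡ tail) (head i f≈0)
    where
    tail : ∑ (tabulate {n = n} suc) f ≈ ∑ (allFin n) (f ∘ suc)
    tail = trans (reflexive (≡.cong (λ xs → ∑ xs f) (≡.sym (map-tabulate {n = n} id suc)))) (∑-map suc (allFin n) f)
    head : ∀ i → (∀ j → j ≢ i → f j ≈ 0#) → f zero + ∑ (allFin n) (f ∘ suc) ≈ f i
    head zero f≈0 = trans (+-congˡ (trans (∑-cong (allFin n) (λ j → f≈0 (suc j) λ ())) (∑-zero (allFin n)))) (+-identityʳ _)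
    head (suc i) f≈0 = trans (+-cong (f≈0 zero λ ())
      (allFin-sifting n (f ∘ suc) i λ j j≢i → f≈0 (suc j) λ { ≡.refl → j≢i ≡.refl })) (+-identityˡ _)

  map-sifting : ∀ {X Y : Set} (X↔Y : X ↔ Y) ys → Sifting ys → Sifting (map (Inverse.from X↔Y) ys)
  map-sifting X↔Y ys sift f x f≈0 = begin
    ∑ (map from ys) f    ≈⟨ ∑-map from ys f ⟩
    ∑ ys (f ∘ from)      ≈⟨ sift (f ∘ from) (to x) (λ y y≢tox → f≈0 (from y) λ fromy≡x → y≢tox (≡.sym (inverseˡ (≡.sym fromy≡x)))) ⟩
    f (from (to x))      ≡⟨ ≡.cong f (inverseʳ ≡.refl) ⟩
    f x                  ∎
    where open Inverse X↔Y

  module _ {X : Set} (_≟_ : DecidableEquality X) (xs : List X) (sift : Sifting xs) where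

    ∑-sift : ∀ (f : X → Carrier) x → ∑ xs (λ y → [ does (x ≟ y) ] * f y) ≈ f x
    ∑-sift f x = trans
      (sift _ x (λ y y≢x → trans (*-congʳ ([]-no (x ≟ y) (y≢x ∘ ≡.sym))) (zeroˡ _)))
      (trans (*-congʳ ([]-yes (x ≟ x) ≡.refl)) (*-identityˡ _))

    -- Write `f (φ x)` as a sum over `y` against the bracket of `φ x = y` and interchange. For fixed
    -- `y` the bracket singles out `x = ψ y`, so each column contributes `f y`. Sifting thus
    -- replaces any reasoning about permuted lists.
    ∑-reindex : ∀ {φ ψ : X → X} → (∀ x → φ (ψ x) ≡ x) → (∀ x → ψ (φ x) ≡ x) →
                ∀ f → ∑ xs (f ∘ φ) ≈ ∑ xs f
    ∑-reindex {φ} {ψ} φψ ψφ f = begin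
      ∑ xs (f ∘ φ)                                           ≈⟨ ∑-cong xs (λ x → ∑-sift f (φ x)) ⟨
      ∑ xs (λ x → ∑ xs (λ y → [ does (φ x ≟ y) ] * f y))     ≈⟨ ∑-comm xs xs _ ⟩
      ∑ xs (λ y → ∑ xs (λ x → [ does (φ x ≟ y) ] * f y))     ≈⟨ ∑-cong xs column ⟩
      ∑ xs f                                                 ∎
      where
      column : ∀ y → ∑ xs (λ x → [ does (φ x ≟ y) ] * f y) ≈ f y
      column y = trans (∑-cong xs (λ x → *-congʳ (reflexive (≡.cong [_] (transpose x))))) (∑-sift (λ _ → f y) (ψ y))
        where
        transpose : ∀ x → does (φ x ≟ y) ≡ does (ψ y ≟ x)
        transpose x with φ x ≟ y | ψ y ≟ x
        ... | yes _    | yes _    = ≡.refl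
        ... | no _     | no _     = ≡.refl
        ... | yes φx≡y | no ψy≢x  = ⊥-elim (ψy≢x (≡.trans (≡.cong ψ (≡.sym φx≡y)) (ψφ x)))
        ... | no φx≢y  | yes ψy≡x = ⊥-elim (φx≢y (≡.trans (≡.cong φ (≡.sym ψy≡x)) (φψ y)))

-- Kernels, adjoints, and stability in the Cauchy-Schwarz inequality.

module InnerProducts {a} (ℝ : CompleteOrderedField a) where
  open RealOperations ℝ
  open CommutativeRing (CompleteOrderedField.commutativeRing ℝ)
    hiding (Carrier; _≈_; _+_; _*_; -_; _-_; 0#; 1#; +-rawMonoid; sym; zero)
  open OrderedFieldProperties ℝ
  open OrderedFieldTheory ℝ
  open Summation ℝ
  open IntegerCoefficientSolver (CompleteOrderedField.commutativeRing ℝ)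
  open import Relation.Binary.Reasoning.Setoid setoid

  ∑-² : ∀ {x} {X : Set x} (xs : List X) p r (f g : X → Carrier) →
    ∑ xs (λ x → (p * f x - r * g x) ²) ≈
    p ² * ∑ xs (λ x → f x ²) + r ² * ∑ xs (λ x → g x ²) - (p * r + p * r) * ∑ xs (λ x → f x * g x)
  ∑-² []       p r f g = solve 2 (λ p r → con (+ 0) :=
    p :* p :* con (+ 0) :+ r :* r :* con (+ 0) :- (p :* r :+ p :* r) :* con (+ 0)) refl p r
  ∑-² (x ∷ xs) p r f g = trans (+-congˡ (∑-² xs p r f g))
    (solve 7 (λ p r u v F G H →
        (p :* u :- r :* v) :* (p :* u :- r :* v) :+ (p :* p :* F :+ r :* r :* G :- (p :* r :+ p :* r) :* H) :=
        p :* p :* (u :* u :+ F) :+ r :* r :* (v :* v :+ G) :- (p :* r :+ p :* r) :* (u :* v :+ H))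
      refl p r (f x) (g x) _ _ _)

  module Kernel {X Y : Set} (xs : List X) (ys : List Y) (K : X → Y → Carrier) where

    apply : (Y → Carrier) → X → Carrier
    apply z x = ∑ ys (λ y → K x y * z y)

    adjoint : (X → Carrier) → Y → Carrier
    adjoint h y = ∑ xs (λ x → h x * K x y)

    adjointness : ∀ h z → ∑ ys (λ y → adjoint h y * z y) ≈ ∑ xs (λ x → h x * apply z x)
    adjointness h z = begin
      ∑ ys (λ y → adjoint h y * z y)                    ≈⟨ ∑-cong ys (λ y → trans (*-comm _ _) (*-distribˡ-∑ xs _ _)) ⟩
      ∑ ys (λ y → ∑ xs (λ x → z y * (h x * K x y)))     ≈⟨ ∑-comm ys xs _ ⟩
      ∑ xs (λ x → ∑ ys (λ y → z y * (h x * K x y)))     ≈⟨ ∑-cong xs (λ x → trans (∑-cong ys (λ y →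
                                                            solve 3 (λ z h k → z :* (h :* k) := h :* (k :* z)) refl _ _ _))
                                                            (sym (*-distribˡ-∑ ys _ _))) ⟩
      ∑ xs (λ x → h x * apply z x)                      ∎

    module Coisometry {α} (0<α : 0# < α) (KK*≈α : ∀ h x → apply (adjoint h) x ≈ α * h x) where

      ‖adjoint‖² : ∀ h → ∑ ys (λ y → adjoint h y ²) ≈ α * ∑ xs (λ x → h x ²)
      ‖adjoint‖² h = begin
        ∑ ys (λ y → adjoint h y ²)               ≈⟨ adjointness h (adjoint h) ⟩
        ∑ xs (λ x → h x * apply (adjoint h) x)   ≈⟨ ∑-cong xs (λ x → trans (*-congˡ (KK*≈α h x))
                                                      (solve 2 (λ h α → h :* (α :* h) := α :* (h :* h)) refl (h x) α)) ⟩
        ∑ xs (λ x → α * h x ²)                   ≈⟨ *-distribˡ-∑ xs α _ ⟨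
        α * ∑ xs (λ x → h x ²)                   ∎

      -- Expand 0 ≤ ‖α z - K* K z‖², using K K* = α.
      ‖apply‖²≤ : ∀ z → ∑ xs (λ x → apply z x ²) ≤ α * ∑ ys (λ y → z y ²)
      ‖apply‖²≤ z = 0≤y-x⇒x≤y (*-cancelˡ-≤ 0<α (≤-respʳ-≈ expansion
        (≤-respˡ-≈ (sym (zeroʳ α)) (∑-nonneg ys (λ y → ²-nonneg (α * z y - 1# * adjoint (apply z) y))))))
        where
        Z G : Carrier
        Z = ∑ ys (λ y → z y ²)
        G = ∑ xs (λ x → apply z x ²)
        expansion : ∑ ys (λ y → (α * z y - 1# * adjoint (apply z) y) ²) ≈ α * (α * Z - G)
        expansion = trans (∑-² ys α 1# z (adjoint (apply z)))
          (trans (+-cong (+-congˡ (*-congˡ (‖adjoint‖² (apply z))))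
                   (-‿cong (*-congˡ (trans (∑-cong ys (λ y → *-comm _ _)) (adjointness (apply z) z)))))
            (solve 3 (λ α Z G → α :* α :* Z :+ con (+ 1) :* con (+ 1) :* (α :* G)
                                  :- (α :* con (+ 1) :+ α :* con (+ 1)) :* G := α :* (α :* Z :- G)) refl α Z G))

  -- ε is the sign of the inner product σ, s is |σ| and D is the Cauchy–Schwarz bound √A √B.
  module CauchySchwarz {Z : Set} (zs : List Z) (f g : Z → Carrier) {A B σ ε s D}
    (0<A : 0# < A) (0<B : 0# < B)
    (‖f‖²≈A : ∑ zs (λ z → f z ²) ≈ A) (‖g‖²≤B : ∑ zs (λ z → g z ²) ≤ B)
    (⟨f,g⟩≈σ : ∑ zs (λ z → f z * g z) ≈ σ)
    (ε²≈1 : ε ² ≈ 1#) (εσ≈s : ε * σ ≈ s) (D≈√A√B : D ≈ √ A * √ B) where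

    private
      i j : Carrier
      i = √ A ⁻¹
      j = √ B ⁻¹

      √Ai≈1 : √ A * i ≈ 1#
      √Ai≈1 = ⁻¹-inverseʳ (√-pos 0<A)

      √Bj≈1 : √ B * j ≈ 1#
      √Bj≈1 = ⁻¹-inverseʳ (√-pos 0<B)

      i²A≈1 : i ² * A ≈ 1#
      i²A≈1 = trans (*-congˡ (sym (√x²≈x (inj₁ 0<A))))
        (trans (solve 2 (λ i r → i :* i :* (r :* r) := (r :* i) :* (r :* i)) refl i (√ A))
          (trans (*-cong √Ai≈1 √Ai≈1) (*-identityˡ 1#)))

      j²B≈1 : j ² * B ≈ 1#
      j²B≈1 = trans (*-congˡ (sym (√x²≈x (inj₁ 0<B))))
        (trans (solve 2 (λ i r → i :* i :* (r :* r) := (r :* i) :* (r :* i)) refl j (√ B))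
          (trans (*-cong √Bj≈1 √Bj≈1) (*-identityˡ 1#)))

      ijD≈1 : i * j * D ≈ 1#
      ijD≈1 = trans (*-congˡ D≈√A√B)
        (trans (solve 4 (λ i j u v → i :* j :* (u :* v) := (u :* i) :* (v :* j)) refl i j (√ A) (√ B))
          (trans (*-cong √Ai≈1 √Bj≈1) (*-identityˡ 1#)))

      0≤ij : 0# ≤ i * j
      0≤ij = *-nonneg (inj₁ (⁻¹-pos (√-pos 0<A))) (inj₁ (⁻¹-pos (√-pos 0<B)))

    defect : Z → Carrier
    defect z = f z / √ A - ε * (g z / √ B)

    -- With `i`, `j` the inverses of `√ A`, `√ B` and `G` the squared norm of `g`, the slack splits
    -- as 2δ - ‖defect‖² = (1 - j² G) + 2 (i j s - (1 - δ)). The first term is nonnegative because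
    -- `G ≤ B`, the second because the hypothesis is scaled by `i * j` and `i * j * D ≈ 1#`.
    stability : ∀ {δ} → (1# - δ) * D ≤ s → ∑ zs (λ z → defect z ²) ≤ (1# + 1#) * δ
    stability {δ} near = 0≤y-x⇒x≤y (≤-respʳ-≈ (sym gap) (+-nonneg p₁ (+-nonneg p₂ p₂)))
      where
      G : Carrier
      G = ∑ zs (λ z → g z ²)
      p₁ : 0# ≤ 1# - j ² * G
      p₁ = 0≤y-x (≤-respʳ-≈ j²B≈1 (*-monoˡ-≤ (²-nonneg j) ‖g‖²≤B))
      p₂ : 0# ≤ i * j * s - (1# - δ)
      p₂ = 0≤y-x (≤-respˡ-≈ (trans (solve 4 (λ i j D δ → i :* j :* ((con (+ 1) :- δ) :* D) := i :* j :* D :* (con (+ 1) :- δ)) refl i j D δ)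
             (trans (*-congʳ ijD≈1) (*-identityˡ _))) (*-monoˡ-≤ 0≤ij near))
      -- The sign disappears here: it is squared in the norm of `g`, and turns `σ` into `s` in the
      -- cross term.
      norm : ∑ zs (λ z → defect z ²) ≈ 1# + j ² * G - (i * j * s + i * j * s)
      norm = begin
        ∑ zs (λ z → defect z ²)
          ≈⟨ ∑-cong zs (λ z → solve 5 (λ f g i j ε → (f :* i :- ε :* (g :* j)) :* (f :* i :- ε :* (g :* j)) :=
               (i :* f :- ε :* j :* g) :* (i :* f :- ε :* j :* g)) refl (f z) (g z) i j ε) ⟩
        ∑ zs (λ z → (i * f z - ε * j * g z) ²)
          ≈⟨ ∑-² zs i (ε * j) f g ⟩
        i ² * ∑ zs (λ z → f z ²) + (ε * j) ² * G - (i * (ε * j) + i * (ε * j)) * ∑ zs (λ z → f z * g z)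
          ≈⟨ +-cong (+-congʳ (trans (*-congˡ ‖f‖²≈A) i²A≈1)) (-‿cong (*-congˡ ⟨f,g⟩≈σ)) ⟩
        1# + (ε * j) ² * G - (i * (ε * j) + i * (ε * j)) * σ
          ≈⟨ solve 5 (λ i j ε G σ → con (+ 1) :+ (ε :* j) :* (ε :* j) :* G :- (i :* (ε :* j) :+ i :* (ε :* j)) :* σ :=
               con (+ 1) :+ (ε :* ε) :* (j :* j :* G) :- (i :* j :* (ε :* σ) :+ i :* j :* (ε :* σ))) refl i j ε G σ ⟩
        1# + ε ² * (j ² * G) - (i * j * (ε * σ) + i * j * (ε * σ))
          ≈⟨ +-cong (+-congˡ (trans (*-congʳ ε²≈1) (*-identityˡ _))) (-‿cong (+-cong (*-congˡ εσ≈s) (*-congˡ εσ≈s))) ⟩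
        1# + j ² * G - (i * j * s + i * j * s) ∎
      gap : (1# + 1#) * δ - ∑ zs (λ z → defect z ²) ≈
            (1# - j ² * G) + ((i * j * s - (1# - δ)) + (i * j * s - (1# - δ)))
      gap = trans (+-congˡ (-‿cong norm))
        (solve 3 (λ δ u v → (con (+ 1) :+ con (+ 1)) :* δ :- (con (+ 1) :+ u :- (v :+ v)) :=
           (con (+ 1) :- u) :+ ((v :- (con (+ 1) :- δ)) :+ (v :- (con (+ 1) :- δ)))) refl δ (j ² * G) (i * j * s))

    -- Forwards, `stability` at δ = 0 bounds a sum of squares by zero, so the defect vanishes at
    -- every listed element. Backwards, substituting the multiple gives ε σ = ε² √(B/A) A = √A √B,
    -- which involves the exact norm of `f` and not the norm of `g`.
    equality : (∀ z → z ∈ zs) → (s ≈ D) ⇔ (∀ z → g z ≈ ε * √ (B / A) * f z)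
    equality complete = mk⇔ ⇒ ⇐
      where
      √[B/A]≈√Bi : √ (B / A) ≈ √ B * i
      √[B/A]≈√Bi = *-cancelˡ (√-pos 0<A) (trans (√y*√[x/y]≈√x (inj₁ 0<B) 0<A)
        (sym (trans (solve 3 (λ u v i → u :* (v :* i) := v :* (u :* i)) refl (√ A) (√ B) i)
          (trans (*-congˡ √Ai≈1) (*-identityʳ _)))))

      ⇒ : s ≈ D → ∀ z → g z ≈ ε * √ (B / A) * f z
      ⇒ s≈D z = begin
        g z                                  ≈⟨ x*[y/x]≈y (g z) (√-pos 0<B) ⟨
        √ B * (g z / √ B)                    ≈⟨ *-congˡ (*-identityˡ _) ⟨
        √ B * (1# * (g z / √ B))             ≈⟨ *-congˡ (*-congʳ ε²≈1) ⟨
        -- With `ε² ≈ 1#` inserted, one factor `ε` joins `g z / √ B` to form `f z / √ A - defect z`;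
        -- the other remains as the sign in the conclusion.
        √ B * (ε ² * (g z / √ B))            ≈⟨ solve 5 (λ r ε g j u → r :* (ε :* ε :* (g :* j)) :=
                                                  r :* ε :* (u :- (u :- ε :* (g :* j)))) refl (√ B) ε (g z) j (f z / √ A) ⟩
        √ B * ε * (f z / √ A - defect z)     ≈⟨ *-congˡ (trans (+-congˡ (-‿cong defect≈0)) (+-congˡ -0≈0)) ⟩
        √ B * ε * (f z * i + 0#)             ≈⟨ solve 4 (λ r ε f i → r :* ε :* (f :* i :+ con (+ 0)) := ε :* (r :* i) :* f) refl (√ B) ε (f z) i ⟩
        ε * (√ B * i) * f z                  ≈⟨ *-congʳ (*-congˡ √[B/A]≈√Bi) ⟨
        ε * √ (B / A) * f z                  ∎
        where
        -0≈0 : - 0# ≈ 0#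
        -0≈0 = solve 0 (:- con (+ 0) := con (+ 0)) refl
        near : (1# - 0#) * D ≤ s
        near = inj₂ (trans (solve 1 (λ D → (con (+ 1) :- con (+ 0)) :* D := D) refl D) (sym s≈D))
        defect≈0 : defect z ≈ 0#
        defect≈0 = ²≈0⇒≈0 (≤-antisym
          (≤-respʳ-≈ (zeroʳ _) (≤-trans (term≤∑ (λ z → ²-nonneg (defect z)) (complete z)) (stability near)))
          (²-nonneg (defect z)))

      ⇐ : (∀ z → g z ≈ ε * √ (B / A) * f z) → s ≈ D
      ⇐ g≈ = begin
        s                                             ≈⟨ εσ≈s ⟨
        ε * σ                                         ≈⟨ *-congˡ ⟨f,g⟩≈σ ⟨
        ε * ∑ zs (λ z → f z * g z)                    ≈⟨ *-congˡ (∑-cong zs (λ z → trans (*-congˡ (g≈ z))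
                                                           (solve 2 (λ f c → f :* (c :* f) := c :* (f :* f)) refl (f z) _))) ⟩
        ε * ∑ zs (λ z → ε * √ (B / A) * f z ²)        ≈⟨ *-congˡ (*-distribˡ-∑ zs _ _) ⟨
        ε * (ε * √ (B / A) * ∑ zs (λ z → f z ²))      ≈⟨ *-congˡ (*-cong (*-congˡ √[B/A]≈√Bi) (trans ‖f‖²≈A (sym (√x²≈x (inj₁ 0<A))))) ⟩
        ε * (ε * (√ B * i) * (√ A ²))                 ≈⟨ solve 4 (λ ε u v i → ε :* (ε :* (v :* i) :* (u :* u)) :=
                                                           (ε :* ε) :* (u :* i) :* (u :* v)) refl ε (√ A) (√ B) i ⟩
        ε ² * (√ A * i) * (√ A * √ B)                 ≈⟨ *-cong (*-cong ε²≈1 √Ai≈1) (sym D≈√A√B) ⟩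
        1# * 1# * D                                   ≈⟨ trans (*-congʳ (*-identityˡ 1#)) (*-identityˡ D) ⟩
        D                                             ∎

-- Coordinatewise algebra and enumeration of points.

module PointAlgebra {q} (F : FiniteField q) where
  open FiniteField F
  open module Affine {k} = AffineSpace F k using (Point; _⊕_; _⊖_; _·_; 𝟎)
  open IntegerCoefficientSolver commutativeRing

  +-comm : ∀ x y → x + y ≡ y + x
  +-comm = solve 2 (λ x y → x :+ y := y :+ x) ≡.refl

  ⊕-comm : ∀ {k} (x y : Point {k}) → x ⊕ y ≡ y ⊕ x
  ⊕-comm []       []       = ≡.refl
  ⊕-comm (a ∷ x) (b ∷ y) = ≡.cong₂ _∷_ (+-comm a b) (⊕-comm x y)

  -- The quadratic form axioms speak only of `_⊕_` and `_·_`; this makes them applicable to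
  -- differences.
  ⊖≡⊕-1· : ∀ {k} (x y : Point {k}) → x ⊖ y ≡ x ⊕ (- 1#) · y
  ⊖≡⊕-1· []      []      = ≡.refl
  ⊖≡⊕-1· (a ∷ x) (b ∷ y) = ≡.cong₂ _∷_
    (solve 2 (λ a b → a :- b := a :+ (:- con (+ 1)) :* b) ≡.refl a b) (⊖≡⊕-1· x y)

  [x⊕y]⊖y≡x : ∀ {k} (y x : Point {k}) → (x ⊕ y) ⊖ y ≡ x
  [x⊕y]⊖y≡x []      []      = ≡.refl
  [x⊕y]⊖y≡x (b ∷ y) (a ∷ x) = ≡.cong₂ _∷_ (solve 2 (λ a b → a :+ b :- b := a) ≡.refl a b) ([x⊕y]⊖y≡x y x)

  [x⊖y]⊕y≡x : ∀ {k} (y x : Point {k}) → (x ⊖ y) ⊕ y ≡ x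
  [x⊖y]⊕y≡x []      []      = ≡.refl
  [x⊖y]⊕y≡x (b ∷ y) (a ∷ x) = ≡.cong₂ _∷_ (solve 2 (λ a b → a :- b :+ b := a) ≡.refl a b) ([x⊖y]⊕y≡x y x)

  x⊖y≡𝟎⇒x≡y : ∀ {k} (x y : Point {k}) → x ⊖ y ≡ 𝟎 → x ≡ y
  x⊖y≡𝟎⇒x≡y []      []      _ = ≡.refl
  x⊖y≡𝟎⇒x≡y (a ∷ x) (b ∷ y) e = ≡.cong₂ _∷_
    (≡.trans (solve 2 (λ a b → a := a :- b :+ b) ≡.refl a b)
      (≡.trans (≡.cong (_+ b) (∷-injectiveˡ e)) (solve 1 (λ b → con (+ 0) :+ b := b) ≡.refl b)))
    (x⊖y≡𝟎⇒x≡y x y (∷-injectiveʳ e))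

  ∈-elements : ∀ a → a ∈ elements
  ∈-elements a = ≡.subst (_∈ elements) (Inverse.inverseʳ enumeration ≡.refl)
    (∈-map⁺ (Inverse.from enumeration) (∈-allFin (Inverse.to enumeration a)))

  ∈-vectors : ∀ {d k} (x : Vec Carrier k) → x ∈ AffineSpace.vectors F d k
  ∈-vectors []      = here ≡.refl
  ∈-vectors (a ∷ x) = ∈-cartesianProductWith⁺ _∷_ (∈-elements a) (∈-vectors x)

  -- The elements 0 and 1 are distinct, so the field cannot be in bijection with `Fin 0` or `Fin 1`.
  1<q : 1 ℕ.< q
  1<q = go enumeration
    where
    -- The size is generalised because the fixed parameter `q` cannot be split on.
    go : ∀ {n} → Carrier ↔ Fin n → 1 ℕ.< n
    go {zero} e with Inverse.to e 0#
    ... | ()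
    go {suc zero} e = ⊥-elim (1≢0 (≡.trans (≡.sym (Inverse.inverseʳ e ≡.refl))
      (≡.trans (≡.cong (Inverse.from e) (unique (Inverse.to e 1#) (Inverse.to e 0#))) (Inverse.inverseʳ e ≡.refl))))
      where
      unique : (i j : Fin 1) → i ≡ j
      unique zero zero = ≡.refl
    go {suc (suc n)} e = ℕ.s≤s (ℕ.s≤s ℕ.z≤n)

-- Quadratic forms and the bisector of two points.

module QuadraticFormTheory {q} (F : FiniteField q) {d} (Q : AffineSpace.Point F d → FiniteField.Carrier F)
  (isQuadratic : AffineSpace.IsQuadraticForm F d Q) where
  open FiniteField F
  open AffineSpace F d
  open IsQuadraticForm isQuadratic
  open PointAlgebra F
  open IntegerCoefficientSolver commutativeRing
  open ≡-Reasoning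

  polar-comm : ∀ x y → polar Q x y ≡ polar Q y x
  polar-comm x y = ≡.trans (≡.cong (λ z → Q z - Q x - Q y) (⊕-comm x y))
    (solve 3 (λ a b c → a :- b :- c := a :- c :- b) ≡.refl (Q (y ⊕ x)) (Q x) (Q y))

  -- Homogeneity at -1 gives Q(-c) = Q(c). The polar form is written with `c` first because its
  -- linearity is assumed in the first argument and is needed in the centre.
  Q-⊖ : ∀ x c → Q (x ⊖ c) ≡ Q x + Q c - polar Q c x
  Q-⊖ x c = begin
    Q (x ⊖ c)                                             ≡⟨ ≡.cong Q (⊖≡⊕-1· x c) ⟩
    Q (x ⊕ -c)                                            ≡⟨ solve 3 (λ u v w → u := u :- v :- w :+ v :+ w) ≡.refl (Q (x ⊕ -c)) (Q x) (Q -c) ⟩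
    polar Q x -c + Q x + Q -c                             ≡⟨ ≡.cong₂ (λ u v → u + Q x + v)
                                                               (≡.trans (polar-comm x -c) (polar-· (- 1#) c x)) (homogeneous (- 1#) c) ⟩
    - 1# * polar Q c x + Q x + - 1# * - 1# * Q c          ≡⟨ solve 3 (λ p u v → (:- con (+ 1)) :* p :+ u :+ (:- con (+ 1)) :* (:- con (+ 1)) :* v
                                                               := u :+ v :- p) ≡.refl (polar Q c x) (Q x) (Q c) ⟩
    Q x + Q c - polar Q c x                               ∎
    where
    -c : Point
    -c = (- 1#) · c

  -- Vanishes exactly when one sphere with centre `c` passes through both `x` and `y`.
  gap : Point → Point → Point → Carrier
  gap x y c = Q (x ⊖ c) - Q (y ⊖ c)

  -- The value of `Q` at the centre is common to both radii and cancels, so the gap is affine in the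
  -- centre although each radius is quadratic.
  gap-translate : ∀ x y c t v →
    gap x y (c ⊕ t · v) ≡ gap x y c - t * (polar Q v x - polar Q v y)
  gap-translate x y c t v = begin
    gap x y (c ⊕ t · v)
      ≡⟨ ≡.cong₂ _-_ (Q-⊖ x (c ⊕ t · v)) (Q-⊖ y (c ⊕ t · v)) ⟩
    Q x + Q (c ⊕ t · v) - polar Q (c ⊕ t · v) x - (Q y + Q (c ⊕ t · v) - polar Q (c ⊕ t · v) y)
      ≡⟨ ≡.cong₂ (λ u w → Q x + Q (c ⊕ t · v) - u - (Q y + Q (c ⊕ t · v) - w)) (expand x) (expand y) ⟩
    Q x + Q (c ⊕ t · v) - (polar Q c x + t * polar Q v x) - (Q y + Q (c ⊕ t · v) - (polar Q c y + t * polar Q v y))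
      ≡⟨ solve 9 (λ qx qy r qc a b t l m → qx :+ r :- (a :+ t :* l) :- (qy :+ r :- (b :+ t :* m)) :=
           qx :+ qc :- a :- (qy :+ qc :- b) :- t :* (l :- m)) ≡.refl
           (Q x) (Q y) (Q (c ⊕ t · v)) (Q c) (polar Q c x) (polar Q c y) t (polar Q v x) (polar Q v y) ⟩
    Q x + Q c - polar Q c x - (Q y + Q c - polar Q c y) - t * (polar Q v x - polar Q v y)
      ≡⟨ ≡.cong₂ (λ u w → u - w - t * (polar Q v x - polar Q v y)) (Q-⊖ x c) (Q-⊖ y c) ⟨
    gap x y c - t * (polar Q v x - polar Q v y) ∎
    where
    expand : ∀ z → polar Q (c ⊕ t · v) z ≡ polar Q c z + t * polar Q v z
    expand z = ≡.trans (polar-⊕ c (t · v) z) (≡.cong (λ u → polar Q c z + u) (polar-· t v z))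

  polar-⊖ : ∀ x y c → polar Q (x ⊖ y) c ≡ polar Q c x - polar Q c y
  polar-⊖ x y c = begin
    polar Q (x ⊖ y) c                          ≡⟨ ≡.cong (λ z → polar Q z c) (⊖≡⊕-1· x y) ⟩
    polar Q (x ⊕ (- 1#) · y) c                 ≡⟨ ≡.trans (polar-⊕ x ((- 1#) · y) c) (≡.cong (λ u → polar Q x c + u) (polar-· (- 1#) y c)) ⟩
    polar Q x c + - 1# * polar Q y c           ≡⟨ solve 2 (λ u v → u :+ (:- con (+ 1)) :* v := u :- v) ≡.refl _ _ ⟩
    polar Q x c - polar Q y c                  ≡⟨ ≡.cong₂ _-_ (polar-comm x c) (polar-comm y c) ⟩
    polar Q c x - polar Q c y                  ∎

  x-y≡0⇒x≡y : ∀ {x y} → x - y ≡ 0# → x ≡ y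
  x-y≡0⇒x≡y {x} {y} e = begin
    x            ≡⟨ solve 2 (λ x y → x := x :- y :+ y) ≡.refl x y ⟩
    x - y + y    ≡⟨ ≡.cong (_+ y) e ⟩
    0# + y       ≡⟨ solve 1 (λ y → con (+ 0) :+ y := y) ≡.refl y ⟩
    y            ∎

  x≡y⇒x-y≡0 : ∀ {x y} → x ≡ y → x - y ≡ 0#
  x≡y⇒x-y≡0 {x} ≡.refl = solve 1 (λ x → x :- x := con (+ 0)) ≡.refl x

  x*y≡0⇒x≡0 : ∀ {x y} → y ≢ 0# → x * y ≡ 0# → x ≡ 0#
  x*y≡0⇒x≡0 {x} {y} y≢0 xy≡0 with inverse y y≢0
  ... | i , yi≡1 = begin
    x              ≡⟨ solve 1 (λ x → x := x :* con (+ 1)) ≡.refl x ⟩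
    x * 1#         ≡⟨ ≡.cong (x *_) yi≡1 ⟨
    x * (y * i)    ≡⟨ solve 3 (λ x y i → x :* (y :* i) := x :* y :* i) ≡.refl x y i ⟩
    x * y * i      ≡⟨ ≡.cong (_* i) xy≡0 ⟩
    0# * i         ≡⟨ solve 1 (λ i → con (+ 0) :* i := con (+ 0)) ≡.refl i ⟩
    0#             ∎

  -- If no direction separated `x` from `y`, then `x ⊖ y` would be polar to every vector and hence
  -- zero. Searching the finite list of points produces the witness effectively.
  separating-direction : Nondegenerate Q → ∀ {x y} → x ≢ y → ∃ λ v → polar Q v x - polar Q v y ≢ 0#
  separating-direction nondegenerate {x} {y} x≢y with any? (λ v → ¬? ((polar Q v x - polar Q v y) ≟ 0#)) points
  ... | yes p = satisfied p
  ... | no ¬p = ⊥-elim (x≢y (x⊖y≡𝟎⇒x≡y x y (nondegenerate (x ⊖ y) λ v →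
    ≡.trans (polar-⊖ x y v) (decidable-stable (_ ≟ 0#) λ v≢ → ¬p (lose (∈-vectors v) v≢)))))

-- Sums over the field and over coordinate vectors.

module PointSums {a} (ℝ : CompleteOrderedField a) {q} (F : FiniteField q) where
  private module F = FiniteField F
  open RealOperations ℝ
  open CommutativeRing (CompleteOrderedField.commutativeRing ℝ)
    hiding (Carrier; _≈_; _+_; _*_; -_; _-_; 0#; 1#; +-rawMonoid; sym; zero)
  open OrderedFieldTheory ℝ
  open Summation ℝ
  open import Relation.Binary.Reasoning.Setoid setoid

  elements-sifting : Sifting F.elements
  elements-sifting = map-sifting F.enumeration (allFin q) (allFin-sifting q)

  vectors-sifting : ∀ d k → Sifting (AffineSpace.vectors F d k)
  vectors-sifting d zero    f []      f≈0 = +-identityʳ _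
  vectors-sifting d (suc k) f (b ∷ v) f≈0 = begin
    ∑ (AffineSpace.vectors F d (suc k)) f
      ≈⟨ ∑-cartesianProductWith _∷_ F.elements (AffineSpace.vectors F d k) f ⟩
    ∑ F.elements (λ c → ∑ (AffineSpace.vectors F d k) (λ w → f (c ∷ w)))
      ≈⟨ elements-sifting _ b (λ c c≢b → trans (∑-cong (AffineSpace.vectors F d k) (λ w → f≈0 (c ∷ w) (c≢b ∘ ∷-injectiveˡ)))
           (∑-zero (AffineSpace.vectors F d k))) ⟩
    ∑ (AffineSpace.vectors F d k) (λ w → f (b ∷ w))
      ≈⟨ vectors-sifting d k _ v (λ w w≢v → f≈0 (b ∷ w) (w≢v ∘ ∷-injectiveʳ)) ⟩
    f (b ∷ v) ∎

  ∑-elements-one : ∑ F.elements (λ _ → 1#) ≈ fromℕ q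
  ∑-elements-one = trans (∑-map (Inverse.from F.enumeration) (allFin q) _)
    (trans (∑-one (allFin q)) (reflexive (≡.cong fromℕ (length-tabulate {n = q} id))))

  ∑-product-one : ∀ {x y} {X : Set x} {Y : Set y} (xs : List X) (ys : List Y) {m n} →
    ∑ xs (λ _ → 1#) ≈ m → ∑ ys (λ _ → 1#) ≈ n → ∑ xs (λ _ → ∑ ys (λ _ → 1#)) ≈ m * n
  ∑-product-one xs ys {m} {n} ∑xs ∑ys = begin
    ∑ xs (λ _ → ∑ ys (λ _ → 1#))   ≈⟨ ∑-cong xs (λ _ → trans ∑ys (sym (*-identityʳ n))) ⟩
    ∑ xs (λ _ → n * 1#)            ≈⟨ *-distribˡ-∑ xs n (λ _ → 1#) ⟨
    n * ∑ xs (λ _ → 1#)            ≈⟨ *-congˡ ∑xs ⟩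
    n * m                          ≈⟨ *-comm n m ⟩
    m * n                          ∎

  ∑-vectors-one : ∀ d k → ∑ (AffineSpace.vectors F d k) (λ _ → 1#) ≈ fromℕ (q ^ k)
  ∑-vectors-one d zero    = refl
  ∑-vectors-one d (suc k) = trans (∑-cartesianProductWith _∷_ F.elements (AffineSpace.vectors F d k) _)
    (trans (∑-product-one F.elements (AffineSpace.vectors F d k) ∑-elements-one (∑-vectors-one d k)) (sym (fromℕ-* q (q ^ k))))

-- Spheres through one point and through two points.

module SphereCounting {a} (ℝ : CompleteOrderedField a) {q} (F : FiniteField q) {d}
  (Q : AffineSpace.Point F d → FiniteField.Carrier F)
  (isQuadratic : AffineSpace.IsQuadraticForm F d Q) (nondegenerate : AffineSpace.Nondegenerate F d Q) where
  private module F = FiniteField F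
  open RealOperations ℝ
  open CommutativeRing (CompleteOrderedField.commutativeRing ℝ)
    hiding (Carrier; _≈_; _+_; _*_; -_; _-_; 0#; 1#; +-rawMonoid; sym; zero)
  open OrderedFieldTheory ℝ
  open Summation ℝ
  open PointSums ℝ F
  open AffineSpace F d
  open PointAlgebra F
  open QuadraticFormTheory F Q isQuadratic
  open import Relation.Binary.Reasoning.Setoid setoid

  _≟ₚ_ : DecidableEquality Point
  _≟ₚ_ = ≡-dec F._≟_

  ∑Ω : ∀ f → ∑ Ω f ≈ ∑ points (λ c → ∑ F.elements (λ r → f (c , r)))
  ∑Ω = ∑-cartesianProductWith _,_ points F.elements

  ∈-Ω : ∀ T → T ∈ Ω
  ∈-Ω (c , r) = ∈-cartesianProduct⁺ (∈-vectors c) (∈-elements r)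

  ∑Ω-one : ∑ Ω (λ _ → 1#) ≈ fromℕ (q ^ suc d)
  ∑Ω-one = trans (∑Ω _) (trans (∑-product-one points F.elements (∑-vectors-one d d) ∑-elements-one)
    (trans (*-comm _ _) (sym (fromℕ-* q (q ^ d)))))

  ⟦_∈_⟧ : Point → Sphere → Carrier
  ⟦ x ∈ T ⟧ = [ inSphere Q x T ]

  [same-radius] : Point → Point → Point → Carrier
  [same-radius] x y c = [ does (Q (y ⊖ c) F.≟ Q (x ⊖ c)) ]

  -- Each centre `c` carries exactly one sphere through `x`, the one of radius `Q (x ⊖ c)`.
  degree : ∀ x → ∑ Ω (λ T → ⟦ x ∈ T ⟧) ≈ fromℕ (q ^ d)
  degree x = begin
    ∑ Ω (λ T → ⟦ x ∈ T ⟧)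
      ≈⟨ ∑Ω _ ⟩
    ∑ points (λ c → ∑ F.elements (λ r → ⟦ x ∈ (c , r) ⟧))
      ≈⟨ ∑-cong points (λ c → trans (∑-cong F.elements (λ r → sym (*-identityʳ _)))
           (∑-sift F._≟_ F.elements elements-sifting (λ _ → 1#) (Q (x ⊖ c)))) ⟩
    ∑ points (λ _ → 1#)
      ≈⟨ ∑-vectors-one d d ⟩
    fromℕ (q ^ d) ∎

  -- For a given centre, `x` fixes the radius and `y` has to agree with it, so common spheres are
  -- counted by their centres.
  codegree : ∀ x y → ∑ Ω (λ T → ⟦ x ∈ T ⟧ * ⟦ y ∈ T ⟧) ≈ ∑ points ([same-radius] x y)
  codegree x y = trans (∑Ω _)
    (∑-cong points (λ c → ∑-sift F._≟_ F.elements elements-sifting (λ r → ⟦ y ∈ (c , r) ⟧) (Q (x ⊖ c))))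

  [same-radius]-diagonal : ∀ x c → [same-radius] x x c ≈ 1#
  [same-radius]-diagonal x c = []-yes (_ F.≟ _) ≡.refl

  -- Along a line in a separating direction the two radii agree exactly once,
  -- and summing over the translates of the whole space counts every centre q times.
  q*codegree : ∀ {x y} → x ≢ y → fromℕ q * ∑ points ([same-radius] x y) ≈ fromℕ (q ^ d)
  q*codegree {x} {y} x≢y with separating-direction nondegenerate x≢y
  ... | v , ℓ≢0 = begin
    fromℕ q * N                                                              ≈⟨ *-comm _ _ ⟩
    N * fromℕ q                                                              ≈⟨ *-congˡ ∑-elements-one ⟨
    N * ∑ F.elements (λ _ → 1#)                                              ≈⟨ *-distribˡ-∑ F.elements N _ ⟩
    ∑ F.elements (λ _ → N * 1#)                                              ≈⟨ ∑-cong F.elements (λ t → trans (*-identityʳ N) (sym (translate t))) ⟩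
    ∑ F.elements (λ t → ∑ points (λ c → [same-radius] x y (c ⊕ t · v)))      ≈⟨ ∑-comm F.elements points _ ⟩
    ∑ points (λ c → ∑ F.elements (λ t → [same-radius] x y (c ⊕ t · v)))      ≈⟨ ∑-cong points line ⟩
    ∑ points (λ _ → 1#)                                                      ≈⟨ ∑-vectors-one d d ⟩
    fromℕ (q ^ d)                                                            ∎
    where
    N : Carrier
    N = ∑ points ([same-radius] x y)
    ℓ ℓ⁻¹ : F.Carrier
    ℓ = polar Q v x F.- polar Q v y
    ℓ⁻¹ = proj₁ (F.inverse ℓ ℓ≢0)
    translate : ∀ t → ∑ points (λ c → [same-radius] x y (c ⊕ t · v)) ≈ N
    translate t = ∑-reindex _≟ₚ_ points (vectors-sifting d d) {λ c → c ⊕ t · v} {λ c → c ⊖ t · v}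
      ([x⊖y]⊕y≡x (t · v)) ([x⊕y]⊖y≡x (t · v)) ([same-radius] x y)
    line : ∀ c → ∑ F.elements (λ t → [same-radius] x y (c ⊕ t · v)) ≈ 1#
    line c = trans (elements-sifting _ t₀ off) on
      where
      -- The unique zero of the affine function t ↦ gap - t ℓ, which exists because ℓ ≠ 0.
      t₀ : F.Carrier
      t₀ = gap x y c F.* ℓ⁻¹
      open IntegerCoefficientSolver F.commutativeRing
      t₀ℓ≡gap : t₀ F.* ℓ ≡ gap x y c
      t₀ℓ≡gap = ≡.trans (solve 3 (λ g i l → g :* i :* l := l :* i :* g) ≡.refl (gap x y c) ℓ⁻¹ ℓ)
        (≡.trans (≡.cong (F._* gap x y c) (proj₂ (F.inverse ℓ ℓ≢0)))
          (solve 1 (λ g → con (+ 1) :* g := g) ≡.refl (gap x y c)))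
      gap-on-line : ∀ t → gap x y (c ⊕ t · v) ≡ (t₀ F.- t) F.* ℓ
      gap-on-line t = ≡.trans (gap-translate x y c t v) (≡.trans (≡.cong (F._- t F.* ℓ) (≡.sym t₀ℓ≡gap))
        (solve 3 (λ s t l → s :* l :- t :* l := (s :- t) :* l) ≡.refl t₀ t ℓ))
      off : ∀ t → t ≢ t₀ → [same-radius] x y (c ⊕ t · v) ≈ 0#
      off t t≢t₀ = []-no (_ F.≟ _) λ e → t≢t₀ (≡.sym (x-y≡0⇒x≡y
        (x*y≡0⇒x≡0 ℓ≢0 (≡.trans (≡.sym (gap-on-line t)) (x≡y⇒x-y≡0 (≡.sym e))))))
      on : [same-radius] x y (c ⊕ t₀ · v) ≈ 1#
      on = []-yes (_ F.≟ _) (≡.sym (x-y≡0⇒x≡y (≡.trans (gap-on-line t₀)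
        (solve 2 (λ t l → (t :- t) :* l := con (+ 0)) ≡.refl t₀ ℓ))))

-- The centred incidence kernel and the norms it produces.

module SphereIncidence {a} (ℝ : CompleteOrderedField a) {q} (F : FiniteField q) {e}
  (Q : AffineSpace.Point F (suc e) → FiniteField.Carrier F)
  (isQuadratic : AffineSpace.IsQuadraticForm F (suc e) Q)
  (nondegenerate : AffineSpace.Nondegenerate F (suc e) Q)
  (P : FinSubset (AffineSpace.Point F (suc e))) (P-nonempty : Nonempty P)
  (𝒮 : FinSubset (AffineSpace.Sphere F (suc e))) (𝒮-nonempty : Nonempty 𝒮) (𝒮-proper : Proper 𝒮) where
  private module F = FiniteField F
  open RealOperations ℝ
  open CommutativeRing (CompleteOrderedField.commutativeRing ℝ)
    hiding (Carrier; _≈_; _+_; _*_; -_; _-_; 0#; 1#; +-rawMonoid; sym; zero)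
  open IsStrictTotalOrder isStrictTotalOrder using (<-respʳ-≈)
  open CompleteOrderedField ℝ using (*-pos)
  open OrderedFieldProperties ℝ using (≤-respˡ-≈)
  open OrderedFieldTheory ℝ
  open Summation ℝ
  open InnerProducts ℝ
  open PointSums ℝ F
  open SphereCounting ℝ F Q isQuadratic nondegenerate
  open AffineSpace F (suc e)
  open PointAlgebra F
  open Incidence ℝ F Q P 𝒮
  open IntegerCoefficientSolver (CompleteOrderedField.commutativeRing ℝ)
  open import Relation.Binary.Reasoning.Setoid setoid

  private
    -- This is q^(d-1). Writing the dimension as `suc e` lets `d ∸ 1` reduce to `e`, so `α` unfolds
    -- to q^d - `β`.
    β : Carrier
    β = fromℕ (q ^ e)

  0<𝐪 : 0# < 𝐪
  0<𝐪 = fromℕ-mono-< (ℕₚ.<-trans (ℕ.s≤s ℕ.z≤n) 1<q)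

  0<β : 0# < β
  0<β = fromℕ-mono-< (ℕₚ.m^n>0 q {{ℕ.>-nonZero (ℕₚ.<-trans (ℕ.s≤s ℕ.z≤n) 1<q)}} e)

  q^d≈𝐪β : fromℕ (q ^ suc e) ≈ 𝐪 * β
  q^d≈𝐪β = fromℕ-* q (q ^ e)

  M≈𝐪𝐪β : M ≈ 𝐪 * (𝐪 * β)
  M≈𝐪𝐪β = trans (fromℕ-* q (q ^ suc e)) (*-congˡ q^d≈𝐪β)

  0<M : 0# < M
  0<M = <-respʳ-≈ (sym M≈𝐪𝐪β) (*-pos 0<𝐪 (*-pos 0<𝐪 0<β))

  0<α : 0# < α
  0<α = 0<y-x (fromℕ-mono-< (ℕₚ.^-monoʳ-< q 1<q (ℕₚ.n<1+n e)))

  -- On the diagonal the count is the degree q^d = α + β, off it β. Thus α is the excess of the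
  -- degree over the codegree of distinct points.
  codegree-value : ∀ x y → ∑ Ω (λ T → ⟦ x ∈ T ⟧ * ⟦ y ∈ T ⟧) ≈ [ does (x ≟ₚ y) ] * α + β
  codegree-value x y = trans (codegree x y) (value (x ≟ₚ y))
    where
    value : ∀ x≟y → ∑ points ([same-radius] x y) ≈ [ does x≟y ] * α + β
    value (yes ≡.refl) = trans (∑-cong points ([same-radius]-diagonal x))
      (trans (∑-vectors-one (suc e) (suc e))
        (solve 2 (λ u v → u := con (+ 1) :* (u :- v) :+ v) refl (fromℕ (q ^ suc e)) β))
    -- The count is known only after multiplication by q, as q^d = q β, and q is cancelled.
    value (no x≢y) = *-cancelˡ 0<𝐪 (trans (q*codegree x≢y) (trans q^d≈𝐪β
      (solve 3 (λ u v w → u :* v := u :* (con (+ 0) :* w :+ v)) refl 𝐪 β α)))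

  K : Point → Sphere → Carrier
  K x T = ⟦ x ∈ T ⟧ - 𝐪 ⁻¹

  open Kernel points Ω K

  𝐪𝐪⁻¹≈1 : 𝐪 * 𝐪 ⁻¹ ≈ 1#
  𝐪𝐪⁻¹≈1 = ⁻¹-inverseʳ 0<𝐪

  -- Every degree is q β and there are q² β spheres. Each of the two linear corrections therefore
  -- subtracts β and the constant one restores β, cancelling the off-diagonal value.
  ⟨K,K⟩ : ∀ x y → ∑ Ω (λ T → K x T * K y T) ≈ [ does (x ≟ₚ y) ] * α
  ⟨K,K⟩ x y = begin
    ∑ Ω (λ T → K x T * K y T)
      ≈⟨ ∑-centred Ω (𝐪 ⁻¹) (𝐪 ⁻¹) ⟦ x ∈_⟧ ⟦ y ∈_⟧ ⟩
    _ - ∑ Ω ⟦ x ∈_⟧ * 𝐪 ⁻¹ - (∑ Ω ⟦ y ∈_⟧ - ∑ Ω (λ _ → 1#) * 𝐪 ⁻¹) * 𝐪 ⁻¹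
      ≈⟨ +-cong (+-cong (codegree-value x y) (-‿cong (*-congʳ (trans (degree x) q^d≈𝐪β))))
           (-‿cong (*-congʳ (+-cong (trans (degree y) q^d≈𝐪β) (-‿cong (*-congʳ (trans ∑Ω-one M≈𝐪𝐪β)))))) ⟩
    [ does (x ≟ₚ y) ] * α + β - 𝐪 * β * 𝐪 ⁻¹ - (𝐪 * β - 𝐪 * (𝐪 * β) * 𝐪 ⁻¹) * 𝐪 ⁻¹
      ≈⟨ solve 4 (λ u b q i → u :+ b :- q :* b :* i :- (q :* b :- q :* (q :* b) :* i) :* i :=
           u :+ b :- q :* i :* b :- (q :* i :* b :- q :* i :* (q :* i) :* b)) refl ([ does (x ≟ₚ y) ] * α) β 𝐪 (𝐪 ⁻¹) ⟩
    [ does (x ≟ₚ y) ] * α + β - 𝐪 * 𝐪 ⁻¹ * β - (𝐪 * 𝐪 ⁻¹ * β - 𝐪 * 𝐪 ⁻¹ * (𝐪 * 𝐪 ⁻¹) * β)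
      ≈⟨ +-cong (+-congˡ (-‿cong (*-congʳ 𝐪𝐪⁻¹≈1)))
           (-‿cong (+-cong (*-congʳ 𝐪𝐪⁻¹≈1) (-‿cong (*-congʳ (*-cong 𝐪𝐪⁻¹≈1 𝐪𝐪⁻¹≈1))))) ⟩
    [ does (x ≟ₚ y) ] * α + β - 1# * β - (1# * β - 1# * 1# * β)
      ≈⟨ solve 2 (λ u b → u :+ b :- con (+ 1) :* b :- (con (+ 1) :* b :- con (+ 1) :* con (+ 1) :* b) := u) refl _ β ⟩
    [ does (x ≟ₚ y) ] * α ∎

  KK*≈α : ∀ h x → apply (adjoint h) x ≈ α * h x
  KK*≈α h x = begin
    ∑ Ω (λ T → K x T * adjoint h T)                            ≈⟨ ∑-cong Ω (λ T → *-distribˡ-∑ points _ _) ⟩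
    ∑ Ω (λ T → ∑ points (λ y → K x T * (h y * K y T)))         ≈⟨ ∑-comm Ω points _ ⟩
    ∑ points (λ y → ∑ Ω (λ T → K x T * (h y * K y T)))         ≈⟨ ∑-cong points (λ y → trans (∑-cong Ω (λ T →
                                                                    solve 3 (λ k h l → k :* (h :* l) := h :* (k :* l)) refl (K x T) (h y) (K y T)))
                                                                    (sym (*-distribˡ-∑ Ω (h y) _))) ⟩
    ∑ points (λ y → h y * ∑ Ω (λ T → K x T * K y T))           ≈⟨ ∑-cong points (λ y → trans (*-congˡ (⟨K,K⟩ x y))
                                                                    (solve 3 (λ h i α → h :* (i :* α) := α :* (i :* h)) refl (h y) _ α)) ⟩
    ∑ points (λ y → α * ([ does (x ≟ₚ y) ] * h y))             ≈⟨ *-distribˡ-∑ points α _ ⟨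
    α * ∑ points (λ y → [ does (x ≟ₚ y) ] * h y)               ≈⟨ *-congˡ (∑-sift _≟ₚ_ points (vectors-sifting (suc e) (suc e)) h x) ⟩
    α * h x                                                    ∎

  open Coisometry 0<α KK*≈α

  w : Sphere → Carrier
  w T = 𝟏 𝒮 T - 𝐬 / M

  f : Sphere → Carrier
  f T = ∣P∩ T ∣ - 𝐧 / 𝐪

  g : Point → Carrier
  g x = d𝒮 x - 𝐬 / 𝐪

  𝐧≈∑ : 𝐧 ≈ ∑ points (𝟏 P)
  𝐧≈∑ = fromℕ-card points P

  𝐬≈∑ : 𝐬 ≈ ∑ Ω (𝟏 𝒮)
  𝐬≈∑ = fromℕ-card Ω 𝒮

  f≈adjoint : ∀ T → f T ≈ adjoint (𝟏 P) T
  f≈adjoint T = sym (trans (∑-centredʳ points (𝐪 ⁻¹) (𝟏 P) (λ x → ⟦ x ∈ T ⟧))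
    (+-cong (trans (∑-cong points (λ x → sym ([]-∧ (P x) _))) (sym (fromℕ-card points _)))
      (-‿cong (*-congʳ (sym 𝐧≈∑)))))

  d𝒮≈∑ : ∀ x → d𝒮 x ≈ ∑ Ω (λ T → ⟦ x ∈ T ⟧ * 𝟏 𝒮 T)
  d𝒮≈∑ x = trans (fromℕ-card Ω _) (∑-cong Ω (λ T → trans ([]-∧ (𝒮 T) _) (*-comm _ _)))

  -- Centring the indicator of 𝒮 subtracts q β (s/M), and the correction from centring `K` restores
  -- q² β (s/M) / q. These cancel, leaving only the mean s/q.
  g≈apply : ∀ x → g x ≈ apply w x
  g≈apply x = sym (begin
    apply w x
      ≈⟨ ∑-centred Ω (𝐪 ⁻¹) (𝐬 / M) ⟦ x ∈_⟧ (𝟏 𝒮) ⟩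
    ∑ Ω (λ T → ⟦ x ∈ T ⟧ * 𝟏 𝒮 T) - ∑ Ω ⟦ x ∈_⟧ * (𝐬 / M) - (∑ Ω (𝟏 𝒮) - ∑ Ω (λ _ → 1#) * (𝐬 / M)) * 𝐪 ⁻¹
      ≈⟨ +-cong (+-cong (sym (d𝒮≈∑ x)) (-‿cong (*-congʳ (trans (degree x) q^d≈𝐪β))))
           (-‿cong (*-congʳ (+-cong (sym 𝐬≈∑) (-‿cong (*-congʳ (trans ∑Ω-one M≈𝐪𝐪β)))))) ⟩
    d𝒮 x - 𝐪 * β * (𝐬 / M) - (𝐬 - 𝐪 * (𝐪 * β) * (𝐬 / M)) * 𝐪 ⁻¹
      ≈⟨ solve 6 (λ d q b t s i → d :- q :* b :* t :- (s :- q :* (q :* b) :* t) :* i :=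
           d :- s :* i :+ (q :* i :- con (+ 1)) :* (q :* b :* t)) refl (d𝒮 x) 𝐪 β (𝐬 / M) 𝐬 (𝐪 ⁻¹) ⟩
    d𝒮 x - 𝐬 / 𝐪 + (𝐪 * 𝐪 ⁻¹ - 1#) * (𝐪 * β * (𝐬 / M))
      ≈⟨ +-congˡ (*-congʳ (+-congʳ 𝐪𝐪⁻¹≈1)) ⟩
    d𝒮 x - 𝐬 / 𝐪 + (1# - 1#) * (𝐪 * β * (𝐬 / M))
      ≈⟨ solve 2 (λ u v → u :+ (con (+ 1) :- con (+ 1)) :* v := u) refl (d𝒮 x - 𝐬 / 𝐪) (𝐪 * β * (𝐬 / M)) ⟩
    g x ∎)

  -- Incidences are counted point by point, each point of `P` contributing its degree in 𝒮.
  ⟨𝟏P,g⟩≈σ : ∑ points (λ x → 𝟏 P x * g x) ≈ σ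
  ⟨𝟏P,g⟩≈σ = trans (∑-centredʳ points (𝐬 / 𝐪) (𝟏 P) d𝒮) (+-cong (sym incidences≈)
    (-‿cong (trans (*-congʳ (sym 𝐧≈∑)) (sym (*-assoc 𝐧 𝐬 _)))))
    where
    incidences≈ : fromℕ incidences ≈ ∑ points (λ x → 𝟏 P x * d𝒮 x)
    incidences≈ = trans (fromℕ-card (cartesianProduct points Ω) _) (trans (∑-cartesianProductWith _,_ points Ω _)
      (∑-cong points (λ x → trans (∑-cong Ω (λ T → []-∧ (P x) _))
        (trans (sym (*-distribˡ-∑ Ω (𝟏 P x) _)) (*-congˡ (sym (fromℕ-card Ω _)))))))

  ⟨f,w⟩≈σ : ∑ Ω (λ T → f T * w T) ≈ σ
  ⟨f,w⟩≈σ = trans (∑-cong Ω (λ T → *-congʳ (f≈adjoint T))) (trans (adjointness (𝟏 P) w)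
    (trans (∑-cong points (λ x → *-congˡ (sym (g≈apply x)))) ⟨𝟏P,g⟩≈σ))

  ‖𝟏P‖²≈𝐧 : ∑ points (λ x → 𝟏 P x ²) ≈ 𝐧
  ‖𝟏P‖²≈𝐧 = trans (∑-cong points (λ x → []-idem (P x))) (sym 𝐧≈∑)

  ‖f‖²≈α𝐧 : ∑ Ω (λ T → f T ²) ≈ α * 𝐧
  ‖f‖²≈α𝐧 = trans (∑-cong Ω (λ T → *-cong (f≈adjoint T) (f≈adjoint T)))
    (trans (‖adjoint‖² (𝟏 P)) (*-congˡ ‖𝟏P‖²≈𝐧))

  W : Carrier
  W = 𝐬 * (1# - 𝐬 / M)

  -- The variance of an indicator of density s/M, scaled by the number of spheres: idempotence gives
  -- s, and removing the mean costs s²/M.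
  ‖w‖²≈W : ∑ Ω (λ T → w T ²) ≈ W
  ‖w‖²≈W = begin
    ∑ Ω (λ T → w T ²)
      ≈⟨ ∑-centred Ω (𝐬 / M) (𝐬 / M) (𝟏 𝒮) (𝟏 𝒮) ⟩
    ∑ Ω (λ T → 𝟏 𝒮 T ²) - ∑ Ω (𝟏 𝒮) * (𝐬 / M) - (∑ Ω (𝟏 𝒮) - ∑ Ω (λ _ → 1#) * (𝐬 / M)) * (𝐬 / M)
      ≈⟨ +-cong (+-cong (trans (∑-cong Ω (λ T → []-idem (𝒮 T))) (sym 𝐬≈∑)) (-‿cong (*-congʳ (sym 𝐬≈∑))))
           (-‿cong (*-congʳ (+-cong (sym 𝐬≈∑) (-‿cong (trans (*-congʳ ∑Ω-one) (x*[y/x]≈y 𝐬 0<M)))))) ⟩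
    𝐬 - 𝐬 * (𝐬 / M) - (𝐬 - 𝐬) * (𝐬 / M)
      ≈⟨ solve 2 (λ s t → s :- s :* t :- (s :- s) :* t := s :* (con (+ 1) :- t)) refl 𝐬 (𝐬 / M) ⟩
    W ∎

  ‖g‖²≤ : ∑ points (λ x → g x ²) ≤ α * 𝐬 * (1# - 𝐬 / M)
  ‖g‖²≤ = ≤-respˡ-≈ (∑-cong points (λ x → sym (*-cong (g≈apply x) (g≈apply x))))
    (≤-respʳ-≈ (trans (*-congˡ ‖w‖²≈W) (sym (*-assoc α 𝐬 _))) (‖apply‖²≤ w))

  0<𝐧 : 0# < 𝐧
  0<𝐧 = <-respʳ-≈ (sym 𝐧≈∑)
    (∑-pos (λ x → []-nonneg (P x)) (∈-vectors (proj₁ P-nonempty)) ([]-pos (proj₂ P-nonempty)))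

  0<𝐬 : 0# < 𝐬
  0<𝐬 = <-respʳ-≈ (sym 𝐬≈∑)
    (∑-pos (λ T → []-nonneg (𝒮 T)) (∈-Ω (proj₁ 𝒮-nonempty)) ([]-pos (proj₂ 𝒮-nonempty)))

  0<M-𝐬 : 0# < M - 𝐬
  0<M-𝐬 = <-respʳ-≈ complement
    (∑-pos (λ T → []-nonneg (not (𝒮 T))) (∈-Ω (proj₁ 𝒮-proper)) ([]-pos (≡.cong not (proj₂ 𝒮-proper))))
    where
    complement : ∑ Ω (λ T → [ not (𝒮 T) ]) ≈ M - 𝐬
    complement = begin
      ∑ Ω (λ T → [ not (𝒮 T) ])                                 ≈⟨ solve 2 (λ u v → u := v :+ u :- v) refl _ (∑ Ω (𝟏 𝒮)) ⟩
      ∑ Ω (𝟏 𝒮) + ∑ Ω (λ T → [ not (𝒮 T) ]) - ∑ Ω (𝟏 𝒮)         ≈⟨ +-cong (∑-distrib-+ Ω _ _) (-‿cong 𝐬≈∑) ⟨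
      ∑ Ω (λ T → 𝟏 𝒮 T + [ not (𝒮 T) ]) - 𝐬                     ≈⟨ +-congʳ (trans (∑-cong Ω (λ T → []+[not]≈1 (𝒮 T))) ∑Ω-one) ⟩
      M - 𝐬                                                     ∎

  0<1-𝐬/M : 0# < 1# - 𝐬 / M
  0<1-𝐬/M = <-respʳ-≈ (trans (solve 3 (λ m s i → (m :- s) :* i := m :* i :- s :* i) refl M 𝐬 (M ⁻¹))
    (+-congʳ (⁻¹-inverseʳ 0<M))) (*-pos 0<M-𝐬 (⁻¹-pos 0<M))

  0<W : 0# < W
  0<W = *-pos 0<𝐬 0<1-𝐬/M

  -- On spheres the product under the root in `Δ` is grouped as α n times W. On points the same
  -- product is grouped as n times α W, so one `Δ` is the Cauchy-Schwarz bound in both spaces.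
  Δ≈√[α𝐧]√W : Δ ≈ √ (α * 𝐧) * √ W
  Δ≈√[α𝐧]√W = trans (√-cong (inj₁ (*-pos (*-pos 0<α 0<𝐧) 0<W)) (sym (*-assoc (α * 𝐧) 𝐬 _)))
    (√-homo-* (inj₁ (*-pos 0<α 0<𝐧)) (inj₁ 0<W))

  0<α𝐬[1-𝐬/M] : 0# < α * 𝐬 * (1# - 𝐬 / M)
  0<α𝐬[1-𝐬/M] = *-pos (*-pos 0<α 0<𝐬) 0<1-𝐬/M

  Δ≈√𝐧√[α𝐬[1-𝐬/M]] : Δ ≈ √ 𝐧 * √ (α * 𝐬 * (1# - 𝐬 / M))
  Δ≈√𝐧√[α𝐬[1-𝐬/M]] = trans (√-cong (inj₁ (*-pos 0<𝐧 0<α𝐬[1-𝐬/M]))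
      (solve 4 (λ α n s t → n :* (α :* s :* t) := α :* n :* s :* t) refl α 𝐧 𝐬 (1# - 𝐬 / M)))
    (√-homo-* (inj₁ 0<𝐧) (inj₁ 0<α𝐬[1-𝐬/M]))

  0<Δ : 0# < Δ
  0<Δ = √-pos (*-pos (*-pos (*-pos 0<α 0<𝐧) 0<𝐬) 0<1-𝐬/M)

  0<∣σ∣ : ∀ {δ} → δ < 1# → (1# - δ) * Δ ≤ ∣ σ ∣ → 0# < ∣ σ ∣
  0<∣σ∣ δ<1 near = <-≤-trans (*-pos (0<y-x δ<1) 0<Δ) near

theorem2p2 :
  ∀ {a} (ℝ : CompleteOrderedField a)
    {q : ℕ} → OddPrimePower q → (F : FiniteField q)
    (d : ℕ) → 2 ℕ.≤ d →
  let open RealOperations ℝ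
      open AffineSpace F d
  in
    (Q : Point → FiniteField.Carrier F) → IsQuadraticForm Q → Nondegenerate Q →
    (P : FinSubset Point) → Nonempty P →
    (𝒮 : FinSubset Sphere) → Nonempty 𝒮 → Proper 𝒮 →
    (δ : Carrier) → 0# ≤ δ → δ < 1# →
  let open Incidence ℝ F Q P 𝒮
  in
    (1# - δ) * Δ ≤ ∣ σ ∣ →
    ( ∑ Ω (λ T → ( (∣P∩ T ∣ - 𝐧 / 𝐪) / √ (α * 𝐧)
                   - ε * ((𝟏 𝒮 T - 𝐬 / M) / √ (𝐬 * (1# - 𝐬 / M))) ) ²)
        ≤ (1# + 1#) * δ )
    ×
    ( ∑ points (λ x → ( 𝟏 P x / √ 𝐧
                        - ε * ((d𝒮 x - 𝐬 / 𝐪) / √ (α * 𝐬 * (1# - 𝐬 / M))) ) ²)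
        ≤ (1# + 1#) * δ )
    ×
    ( (∣ σ ∣ ≈ Δ)
        ⇔ (∀ (T : Sphere) → ∣P∩ T ∣ - 𝐧 / 𝐪
             ≈ ε * √ ((α * 𝐧) / (𝐬 * (1# - 𝐬 / M))) * (𝟏 𝒮 T - 𝐬 / M)) )
    ×
    ( (∣ σ ∣ ≈ Δ)
        ⇔ (∀ (x : Point) → d𝒮 x - 𝐬 / 𝐪
             ≈ ε * √ ((α * 𝐬 * (1# - 𝐬 / M)) / 𝐧) * 𝟏 P x) )
theorem2p2 ℝ _ F (suc e) _ Q isQuadratic nondegenerate P P-nonempty 𝒮 𝒮-nonempty 𝒮-proper δ _ δ<1 near =
  OnSpheres.stability near , OnPoints.stability near ,
  OnSpheresᵒ.equality ∈-Ω , OnPoints.equality ∈-vectors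
  where
  open CompleteOrderedField ℝ using (*-pos)
  open CommutativeRing (CompleteOrderedField.commutativeRing ℝ) using (trans; *-comm)
  open RealOperations ℝ
  open OrderedFieldTheory ℝ
  open Summation ℝ
  open InnerProducts ℝ
  open AffineSpace F (suc e)
  open PointAlgebra F
  open Incidence ℝ F Q P 𝒮
  open SphereCounting ℝ F Q isQuadratic nondegenerate
  open SphereIncidence ℝ F Q isQuadratic nondegenerate P P-nonempty 𝒮 𝒮-nonempty 𝒮-proper

  ε²≈1 : ε ² ≈ 1#
  ε²≈1 = sgn²≈1 (0<∣σ∣ δ<1 near)

  module OnSpheres = CauchySchwarz Ω f w (*-pos 0<α 0<𝐧) 0<W ‖f‖²≈α𝐧 (inj₂ ‖w‖²≈W) ⟨f,w⟩≈σ
    ε²≈1 (sgn-* σ) Δ≈√[α𝐧]√W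
  -- The roles are exchanged because `equality` solves for its second function, while the identity
  -- on spheres solves for `f`. Both norms are exact here, so either order is available.
  module OnSpheresᵒ = CauchySchwarz Ω w f 0<W (*-pos 0<α 0<𝐧) ‖w‖²≈W (inj₂ ‖f‖²≈α𝐧)
    (trans (∑-cong Ω (λ T → *-comm (w T) (f T))) ⟨f,w⟩≈σ) ε²≈1 (sgn-* σ) (trans Δ≈√[α𝐧]√W (*-comm _ _))
  -- Here the order is forced: 1_P has the exact norm and `g` only the contraction bound.
  module OnPoints = CauchySchwarz points (𝟏 P) g 0<𝐧 0<α𝐬[1-𝐬/M] ‖𝟏P‖²≈𝐧 ‖g‖²≤ ⟨𝟏P,g⟩≈σ
    ε²≈1 (sgn-* σ) Δ≈√𝐧√[α𝐬[1-𝐬/M]]
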